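{- Assume the Generalized Riemann Hypothesis. Let $a$ be a positive integer, let $r$ be the largest integer such that $r^2\mid a$, and let $\delta\in(0,\frac12)$ be real. Then \[ A(a,\delta)\ll \delta a(\log\log 3a)\,d(a)+\sigma(r), \] where the implied constant is absolute.
   Context: For real $t$, $\|t\|=\min_{n\in\mathbb{Z}}|t-n|$ is the distance from $t$ to the nearest integer. For a positive integer $a$ and real $\delta>0$, $A(a,\delta)$ is the number of integers $x$ with $1\le x\le a$ and $\left\|\frac{x^2}{a}\right\|\le\delta$. For a positive integer $n$, $d(n)=\sum_{m\mid n}1$ is the number of positive divisors of $n$ and $\sigma(n)=\sum_{m\mid n}m$ is their sum. $\log$ is the natural logarithm and $\log\log 3a=\log(\log(3a))$. The Generalized Riemann Hypothesis is the Riemann Hypothesis for all Dirichlet $L$-functions $L(s,\chi)$: every zero with $0<\operatorname{Re}(s)<1$ has $\operatorname{Re}(s)=\frac12$. The notation $f\ll g$ means that there is a constant $C$ with $|f|\le C|g|$ for all admissible values of the parameters (here $a$ and $\delta$). -}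

module Defs where

open import Level using (0ℓ) renaming (suc to lsuc)
open import Algebra.Bundles using (RawRing)
open import Algebra.Core using (Op₁; Op₂)
open import Algebra.Structures using (IsCommutativeRing)
open import Axiom.ExcludedMiddle using (ExcludedMiddle)
open import Data.Fin.Base using (toℕ)
open import Data.Integer.Base as ℤ using (ℤ; +_; -[1+_])
open import Data.Integer.Coprimality using (Coprime)
open import Data.List.Base using (List; applyUpTo; filter; length)
open import Data.Nat.Base as ℕ using (ℕ; suc; NonZero; _!)
open import Data.Nat.Divisibility using (_∣_; _∣?_)
open import Data.Nat.ListAction using (sum)
open import Data.Product.Base using (Σ; ∃; ∃-syntax; _×_; _,_)
open import Function.Bundles using (_⇔_)
open import Relation.Binary.Core using (Rel)
open import Relation.Binary.Structures using (IsTotalOrder)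
open import Relation.Nullary using (¬_; yes; no)
import Algebra.Definitions.RawSemiring as RawSemiringDefs
import Relation.Binary.Construct.NonStrictToStrict as ToStrict

[1⋯_] : ℕ → List ℕ
[1⋯ n ] = applyUpTo suc n

divisors : ℕ → List ℕ
divisors n = filter (_∣? n) [1⋯ n ]

d : ℕ → ℕ
d n = length (divisors n)

σ : ℕ → ℕ
σ n = sum (divisors n)

IsLargestSquareDivisorRoot : ℕ → ℕ → Set
IsLargestSquareDivisorRoot a r =
  (r ℕ.* r ∣ a) × (∀ s → s ℕ.* s ∣ a → s ℕ.≤ r)

-- The real numbers, axiomatised as a Dedekind-complete ordered field;
-- classically this determines them up to isomorphism.  The inverse is
-- total, with an unspecified value at 0#.
record CompleteOrderedField : Set (lsuc 0ℓ) where
  infix  4 _≈_ _≤_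
  infixl 6 _+_
  infixl 7 _*_
  infix  8 -_
  infix  9 _⁻¹
  field
    Carrier           : Set
    _≈_               : Rel Carrier 0ℓ
    _≤_               : Rel Carrier 0ℓ
    _+_               : Op₂ Carrier
    _*_               : Op₂ Carrier
    -_                : Op₁ Carrier
    0#                : Carrier
    1#                : Carrier
    _⁻¹               : Op₁ Carrier
    isCommutativeRing : IsCommutativeRing _≈_ _+_ _*_ -_ 0# 1#
    0≉1               : ¬ (0# ≈ 1#)
    ⁻¹-cong           : ∀ {x y} → x ≈ y → x ⁻¹ ≈ y ⁻¹
    *-inverseʳ        : ∀ x → ¬ (x ≈ 0#) → x * x ⁻¹ ≈ 1#
    isTotalOrder      : IsTotalOrder _≈_ _≤_
    +-monoʳ-≤         : ∀ x {y z} → y ≤ z → x + y ≤ x + z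
    *-nonNeg          : ∀ {x y} → 0# ≤ x → 0# ≤ y → 0# ≤ x * y

  UpperBound : (Carrier → Set) → Carrier → Set
  UpperBound P u = ∀ x → P x → x ≤ u

  field
    complete : (P : Carrier → Set) → ∃ P → ∃ (UpperBound P) →
               ∃[ u ] (UpperBound P u × (∀ v → UpperBound P v → u ≤ v))

-- Excluded middle provides the classical logic in which the mathematics
-- below is read, and makes definite descriptions and counting available.
module Analysis (em : ExcludedMiddle 0ℓ) (R : CompleteOrderedField) where

  open CompleteOrderedField R public
    using (_≈_; _≤_; _+_; _*_; -_; 0#; 1#; _⁻¹)
    renaming (Carrier to ℝ)

  open ToStrict _≈_ _≤_ public using (_<_)

  -- An element satisfying P, or the default if there is none.  Every
  -- use below has P satisfied by at most one element up to ≈.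
  the : {A : Set} → A → (A → Set) → A
  the {A} default P with em {Σ A P}
  ... | yes (x , _) = x
  ... | no  _       = default

  infixl 6 _-_
  _-_ : Op₂ ℝ
  x - y = x + (- y)

  fromℕ : ℕ → ℝ
  fromℕ ℕ.zero  = 0#
  fromℕ (suc n) = 1# + fromℕ n

  fromℤ : ℤ → ℝ
  fromℤ (+ n)    = fromℕ n
  fromℤ -[1+ n ] = - fromℕ (suc n)

  ½ : ℝ
  ½ = (fromℕ 2) ⁻¹

  abs : ℝ → ℝ
  abs x with em {0# ≤ x}
  ... | yes _ = x
  ... | no  _ = - x

  -- ‖ t ‖ = min { |t - n| : n ∈ ℤ }
  ‖_‖ : ℝ → ℝ
  ‖ t ‖ = the 0# λ m →
    (∃[ n ] m ≈ abs (t - fromℤ n)) × (∀ n → m ≤ abs (t - fromℤ n))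

  A : ℕ → ℝ → ℕ
  A a δ = length (filter (λ x → em {‖ fromℕ (x ℕ.* x) * fromℕ a ⁻¹ ‖ ≤ δ}) [1⋯ a ])

  infix 5 _+i_
  record ℂ : Set where
    constructor _+i_
    field
      re im : ℝ
  open ℂ public

  infix  4 _≈ᶜ_
  infixl 6 _+ᶜ_ _-ᶜ_
  infixl 7 _*ᶜ_
  infix  8 -ᶜ_

  _≈ᶜ_ : Rel ℂ 0ℓ
  z ≈ᶜ w = (re z ≈ re w) × (im z ≈ im w)

  _+ᶜ_ _*ᶜ_ _-ᶜ_ : Op₂ ℂ
  z +ᶜ w = (re z + re w) +i (im z + im w)
  z *ᶜ w = (re z * re w - im z * im w) +i (re z * im w + im z * re w)
  z -ᶜ w = (re z - re w) +i (im z - im w)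

  -ᶜ_ : Op₁ ℂ
  -ᶜ z = (- re z) +i (- im z)

  ofReal : ℝ → ℂ
  ofReal x = x +i 0#

  0ᶜ 1ᶜ : ℂ
  0ᶜ = ofReal 0#
  1ᶜ = ofReal 1#

  ℂ-rawRing : RawRing 0ℓ 0ℓ
  ℂ-rawRing = record
    { Carrier = ℂ ; _≈_ = _≈ᶜ_ ; _+_ = _+ᶜ_ ; _*_ = _*ᶜ_
    ; -_ = -ᶜ_ ; 0# = 0ᶜ ; 1# = 1ᶜ }

  open RawSemiringDefs (RawRing.rawSemiring ℂ-rawRing)
    using () renaming (sum to sumᶜ; _^_ to _^ᶜ_)

  -- ∑[ N ] f = f 0 + ⋯ + f (N - 1)
  ∑[_] : ℕ → (ℕ → ℂ) → ℂ
  ∑[ N ] f = sumᶜ {N} (λ k → f (toℕ k))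

  absᶜ : ℂ → ℝ
  absᶜ z = the 0# λ m → (0# ≤ m) × (m * m ≈ re z * re z + im z * im z)

  infix 4 _⟶_
  _⟶_ : (ℕ → ℂ) → ℂ → Set
  u ⟶ l = ∀ ε → 0# < ε → ∃[ N ] (∀ n → N ℕ.≤ n → absᶜ (u n -ᶜ l) < ε)

  exp : ℂ → ℂ
  exp z = the 0ᶜ λ w →
    (λ N → ∑[ N ] (λ k → (z ^ᶜ k) *ᶜ ofReal (fromℕ (k !) ⁻¹))) ⟶ w

  -- The natural logarithm of a positive real (0# at other arguments).
  log : ℝ → ℝ
  log x = the 0# λ y → exp (ofReal y) ≈ᶜ ofReal x

  -- n ^- s is n⁻ˢ, for positive n.
  _^-_ : ℕ → ℂ → ℂ
  n ^- s = exp (-ᶜ (s *ᶜ ofReal (log (fromℕ n))))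

  -- The condition includes all w ≈ᶜ z, so it forces f to respect ≈ᶜ at z.
  DifferentiableAt : (ℂ → ℂ) → ℂ → Set
  DifferentiableAt f z = ∃[ c ] (∀ ε → 0# < ε → ∃[ η ] ((0# < η) ×
    (∀ w → absᶜ (w -ᶜ z) < η →
       absᶜ (f w -ᶜ f z -ᶜ c *ᶜ (w -ᶜ z)) ≤ ε * absᶜ (w -ᶜ z))))

  record DirichletCharacter (q : ℕ) : Set where
    field
      χ              : ℤ → ℂ
      periodic       : ∀ n → χ (n ℤ.+ + q) ≈ᶜ χ n
      multiplicative : ∀ m n → χ (m ℤ.* n) ≈ᶜ χ m *ᶜ χ n
      support        : ∀ n → (¬ (χ n ≈ᶜ 0ᶜ)) ⇔ Coprime n (+ q)

  -- L is the Dirichlet series of χ on Re s > 1, continued analytically to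
  -- ℂ ∖ {1}.  This determines L on ℂ ∖ {1}; its value at 1, where the
  -- principal characters have a pole, is left unconstrained.
  IsLFunction : {q : ℕ} → DirichletCharacter q → (ℂ → ℂ) → Set
  IsLFunction X L =
    (∀ s → 1# < re s → (λ N → ∑[ N ] (λ k → χ (+ suc k) *ᶜ (suc k ^- s))) ⟶ L s) ×
    (∀ s → ¬ (s ≈ᶜ 1ᶜ) → DifferentiableAt L s)
    where open DirichletCharacter X

  GeneralizedRiemannHypothesis : Set
  GeneralizedRiemannHypothesis =
    ∀ q .{{_ : NonZero q}} (X : DirichletCharacter q) (L : ℂ → ℂ) →
    IsLFunction X L →
    ∀ s → 0# < re s → re s < 1# → L s ≈ᶜ 0ᶜ → re s ≈ ½

{-# OPTIONS --safe #-}

module Submission where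

open import Defs
open import Level using (0ℓ)
open import Algebra.Bundles using (CommutativeRing; RawRing)
import Algebra.Definitions.RawSemiring
import Algebra.Properties.AbelianGroup
import Algebra.Properties.Ring
import Algebra.Solver.Ring
open import Algebra.Solver.Ring.AlmostCommutativeRing using (fromCommutativeRing; _-Raw-AlmostCommutative⟶_)
open import Axiom.ExcludedMiddle using (ExcludedMiddle)
open import Data.Integer.Base as ℤ using (ℤ; +_; -[1+_])
import Data.Integer.Properties as ℤ
open import Data.Integer.Tactic.RingSolver using () renaming (solve-∀ to ℤ-solve)
open import Data.List.Base using (List; []; _∷_; applyUpTo; filter; length; map)
open import Data.List.Membership.Propositional using (_∈_)
open import Data.List.Membership.Propositional.Properties using (∈-applyUpTo⁺; ∈-filter⁺; ∈-filter⁻)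
open import Data.List.Relation.Unary.Any using (here; there)
open import Data.Maybe.Base using (Maybe; just; nothing)
open import Data.Nat.Base as ℕ using (ℕ; zero; suc; NonZero; z≤n; s≤s; _!)
import Data.Nat.Properties as ℕ
open import Data.Nat.Tactic.RingSolver using () renaming (solve-∀ to ℕ-solve)
open import Data.Product.Base using (Σ; ∃; ∃-syntax; _×_; _,_; proj₁; proj₂)
open import Data.Sum.Base using (_⊎_; inj₁; inj₂)
open import Function.Base using (_∘_; id)
open import Relation.Binary.Bundles using (Poset)
import Relation.Binary.Construct.NonStrictToStrict as Strict
open import Relation.Binary.PropositionalEquality as ≡ using (_≡_)
import Relation.Binary.Reasoning.PartialOrder
open import Relation.Binary.Structures using (IsTotalOrder)
open import Relation.Nullary using (¬_; Dec; yes; no; contradiction)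
open import Relation.Nullary.Decidable using (_×-dec_)
open import Relation.Unary using (Decidable)

-- If y² ≡ x² ≡ k (mod a), then a ∣ (x - y)(x + y), so a = g h with g ∣ x - y
-- and h ∣ x + y.  For fixed y, g and u = gcd(g, h), such x repeat with period
-- a / u, and u ∣ 2k.  Hence the number of pairs (x, k) with 0 < |k| ≤ D and
-- x² ≡ k is at most Σ_{g ∣ a} Σ_{0 < |k| ≤ D} u [u ∣ 2k] ≤ 4 D d(a).  For
-- k = 0, a ∣ x² makes x a multiple of a / h for some h with h² ∣ a, that is
-- h ∣ r, which accounts for at most σ(r) values of x.  With D = ⌊δ a⌋ this
-- gives A(a, δ) ≤ 4 δ a d(a) + σ(r), and log log 3a is bounded below by a
-- positive constant.

-- For a single residue k the number u can be large, so no useful bound holds for each pair (g, k)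
-- separately. The saving is an average: with g fixed and k summed, `u ∣ 2 * k` is rare exactly when
-- u is large. This is why the sum over k must end up inside the sum over g.
--
-- The lower bound for log log 3a needs log 3 to exceed 1 by a definite margin. Both `exp` and `log`
-- are definite descriptions over a power series, so this has to be extracted from partial sums. All
-- growth estimates on nonnegative arguments come from the single inequality S(y) ≤ S(x) + (y - x)
-- S(y) for 0 ≤ x ≤ y. A further obstacle is that `log x` is described as any real with the right
-- exponential: a negative candidate has to be excluded, which calls for an upper bound on the
-- series where its terms alternate in sign.

module Counting (em : ExcludedMiddle 0ℓ) where

  open import Data.Integer.Divisibility.Signed
    using ()
    renaming (_∣_ to _∣ᶻ_; _∣?_ to _∣ᶻ?_; divides to dividesᶻ; ∣ᵤ⇒∣ to ∣⇒∣ᶻ; ∣⇒∣ᵤ to ∣ᶻ⇒∣; ∣-trans to ∣ᶻ-trans;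
              ∣m∣n⇒∣m-n to ∣m∣n⇒∣ᶻm-n; ∣n⇒∣m*n to ∣n⇒∣ᶻm*n; *-cancelˡ-∣ to *-cancelˡ-∣ᶻ)
  open import Data.Nat.Base hiding (_/_)
  open import Data.Nat.Coprimality using (Coprime; coprime-divisor; coprime-/gcd)
  open import Data.Nat.DivMod using (_/_; m/n*n≡m)
  open import Data.Nat.Divisibility
  open import Data.Nat.GCD
    using (gcd; gcd[m,n]∣m; gcd[m,n]∣n; gcd-greatest; gcd[m,n]≢0; gcd[m,n]≡0⇒m≡0; c*gcd[m,n]≡gcd[cm,cn])
  open import Data.Nat.LCM using (lcm; lcm-least; gcd*lcm)
  open import Data.Nat.ListAction using (sum)
  open import Data.Nat.Properties hiding (_≟_)
  open import Relation.Binary.PropositionalEquality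
    using (_≡_; refl; sym; trans; cong; subst; subst₂)

  private variable
    I J : Set
    P : Set

  -- Finite sums and counting by indicators

  ∑ : List I → (I → ℕ) → ℕ
  ∑ xs f = sum (map f xs)

  ∑-mono : ∀ (xs : List I) {f g : I → ℕ} → (∀ {x} → x ∈ xs → f x ≤ g x) → ∑ xs f ≤ ∑ xs g
  ∑-mono []       f≤g = z≤n
  ∑-mono (x ∷ xs) f≤g = +-mono-≤ (f≤g (here refl)) (∑-mono xs (f≤g ∘ there))

  ∑-+ : ∀ (xs : List I) (f g : I → ℕ) → ∑ xs (λ x → f x + g x) ≡ ∑ xs f + ∑ xs g
  ∑-+ []       f g = refl
  ∑-+ (x ∷ xs) f g =
      trans (cong (λ s → f x + g x + s) (∑-+ xs f g)) (lemma (f x) (g x) (∑ xs f) (∑ xs g))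
    where
    lemma : ∀ a b c d → a + b + (c + d) ≡ a + c + (b + d)
    lemma = ℕ-solve

  ∑-* : ∀ c (xs : List I) (f : I → ℕ) → ∑ xs (λ x → c * f x) ≡ c * ∑ xs f
  ∑-* c []       f = sym (*-zeroʳ c)
  ∑-* c (x ∷ xs) f = trans (cong (λ s → c * f x + s) (∑-* c xs f)) (sym (*-distribˡ-+ c (f x) _))

  ∑-const : ∀ c (xs : List I) → ∑ xs (λ _ → c) ≡ c * length xs
  ∑-const c []       = sym (*-zeroʳ c)
  ∑-const c (x ∷ xs) = trans (cong (λ s → c + s) (∑-const c xs)) (sym (*-suc c (length xs)))

  ∑-swap : ∀ (xs : List I) (ys : List J) (f : I → J → ℕ) →
           ∑ xs (λ x → ∑ ys (f x)) ≡ ∑ ys (λ y → ∑ xs (λ x → f x y))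
  ∑-swap xs []       f = ∑-const 0 xs
  ∑-swap xs (y ∷ ys) f =
      trans (∑-+ xs (λ x → f x y) (λ x → ∑ ys (f x))) (cong (λ s → _ + s) (∑-swap xs ys f))

  ∈⇒≤∑ : ∀ {xs : List I} {x} (f : I → ℕ) → x ∈ xs → f x ≤ ∑ xs f
  ∈⇒≤∑ f (here refl) = m≤m+n _ _
  ∈⇒≤∑ f (there x∈)  = ≤-trans (∈⇒≤∑ f x∈) (m≤n+m _ _)

  𝟙 : Dec P → ℕ
  𝟙 (yes _) = 1
  𝟙 (no  _) = 0

  𝟙-true : {P : Set} (P? : Dec P) → P → 1 ≤ 𝟙 P?
  𝟙-true (yes _) _ = ≤-refl
  𝟙-true (no ¬p) p = contradiction p ¬p

  𝟙-* : ∀ {P Q R : Set} (P? : Dec P) (Q? : Dec Q) (R? : Dec R) → (P → Q × R) → 𝟙 P? ≤ 𝟙 Q? * 𝟙 R?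
  𝟙-* (no _)  _       _       _    = z≤n
  𝟙-* (yes p) Q? R? P⇒QR = *-mono-≤ (𝟙-true Q? (proj₁ (P⇒QR p))) (𝟙-true R? (proj₂ (P⇒QR p)))

  -- The union bound at one point; summed over the points it becomes the union bound for counts.
  𝟙-∑ : ∀ {P : Set} (P? : Dec P) {Q : I → Set} (Q? : Decidable Q) {xs : List I} →
        (P → ∃[ i ] (i ∈ xs × Q i)) → 𝟙 P? ≤ ∑ xs (λ i → 𝟙 (Q? i))
  𝟙-∑ (no _)  Q? _ = z≤n
  𝟙-∑ (yes p) Q? {xs} f with f p
  ... | i , i∈xs , q = ≤-trans (𝟙-true (Q? i) q) (∈⇒≤∑ (λ i → 𝟙 (Q? i)) i∈xs)

  # : {P : I → Set} → Decidable P → List I → ℕ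
  # P? xs = ∑ xs (λ x → 𝟙 (P? x))

  length-filter : {P : I → Set} (P? : Decidable P) → ∀ xs → length (filter P? xs) ≡ # P? xs
  length-filter P? []       = refl
  length-filter P? (x ∷ xs) with P? x
  ... | yes _ = cong suc (length-filter P? xs)
  ... | no  _ = length-filter P? xs

  ∈-[1⋯] : ∀ {n x} → 1 ≤ x → x ≤ n → x ∈ [1⋯ n ]
  ∈-[1⋯] {x = suc x} _ x≤n = ∈-applyUpTo⁺ suc x≤n

  ∈-divisors : ∀ {n x} .{{_ : NonZero n}} → x ∣ n → x ∈ divisors n
  ∈-divisors {n} {zero}  0∣n = contradiction (0∣⇒≡0 0∣n) (≢-nonZero⁻¹ n)
  ∈-divisors {n} {suc x} x∣n = ∈-filter⁺ (_∣? n) (∈-[1⋯] (s≤s z≤n) (∣⇒≤ x∣n)) x∣n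

  divisors-∣ : ∀ {n x} → x ∈ divisors n → x ∣ n
  divisors-∣ {n} = proj₂ ∘ ∈-filter⁻ (_∣? n) {xs = [1⋯ n ]}

  -- Counting well-spaced sets

  -- Only gaps between hits enter the counts: where all differences of hits are divisible by some
  -- number, that number is a valid spacing by `∣⇒≤`.
  Spaced : (ℕ → Set) → ℕ → Set
  Spaced P L = ∀ i j → i < j → P i → P j → L ≤ j ∸ i

  -- The number w of initial indices known to miss P is what makes the
  -- induction go through: it is ℓ right after a hit.
  #-spaced-from : ∀ {P : I → Set} (P? : Decidable P) (f : ℕ → I) ℓ n w →
    Spaced (P ∘ f) (suc ℓ) → w ≤ ℓ → (∀ i → i < w → ¬ P (f i)) →
    suc ℓ * # P? (applyUpTo f n) + w ≤ n + ℓ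
  #-spaced-from P? f ℓ zero w sp w≤ℓ miss rewrite *-zeroʳ ℓ = w≤ℓ
  #-spaced-from {P = P} P? f ℓ (suc n) w sp w≤ℓ miss with P? (f 0)
  #-spaced-from {P = P} P? f ℓ (suc n) zero sp w≤ℓ miss | yes p = begin
    suc ℓ * suc c + 0   ≡⟨ lemma ℓ c ⟩
    suc (suc ℓ * c + ℓ)
        ≤⟨ s≤s (#-spaced-from P? (f ∘ suc) ℓ n ℓ (λ i j i<j → sp (suc i) (suc j) (s≤s i<j)) ≤-refl
                                (λ i i<ℓ q → <-irrefl
                                  refl (≤-trans (sp 0 (suc i) (s≤s z≤n) p q) i<ℓ))) ⟩
    suc n + ℓ ∎
    where
    open ≤-Reasoning
    c = # P? (applyUpTo (f ∘ suc) n)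
    lemma : ∀ ℓ c → suc ℓ * suc c + 0 ≡ suc (suc ℓ * c + ℓ)
    lemma = ℕ-solve
  #-spaced-from P? f ℓ (suc n) (suc w) sp w≤ℓ miss | yes p = contradiction p (miss 0 (s≤s z≤n))
  #-spaced-from P? f ℓ (suc n) zero sp w≤ℓ miss | no ¬p =
    m≤n⇒m≤1+n (#-spaced-from P? (f ∘ suc) ℓ n 0 (λ i j i<j → sp (suc i) (suc j) (s≤s i<j)) z≤n (λ _ ()))
  #-spaced-from P? f ℓ (suc n) (suc w) sp w≤ℓ miss | no ¬p = begin
    suc ℓ * c + suc w ≡⟨ +-suc _ w ⟩
    suc (suc ℓ * c + w)
        ≤⟨ s≤s (#-spaced-from P? (f ∘ suc) ℓ n w (λ i j i<j → sp (suc i) (suc j) (s≤s i<j)) (<⇒≤ w≤ℓ)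
                              (λ i i<w → miss (suc i) (s≤s i<w))) ⟩
    suc n + ℓ ∎
    where
    open ≤-Reasoning
    c = # P? (applyUpTo (f ∘ suc) n)

  #-spaced : ∀ {P : I → Set} (P? : Decidable P) (f : ℕ → I) L .{{_ : NonZero L}} n →
    Spaced (P ∘ f) L → L * # P? (applyUpTo f n) < n + L
  #-spaced P? f (suc ℓ) n sp = subst₂ _≤_
    (cong suc (+-identityʳ _)) (sym (+-suc n ℓ)) (s≤s (#-spaced-from P? f ℓ n 0 sp z≤n (λ _ ())))

  -- The range is a whole number of gaps, so the strict bound `L * c < L * suc u` rounds down and
  -- the end term `L` costs nothing.
  #-spaced-≤ : ∀ {P : I → Set} (P? : Decidable P) (f : ℕ → I) L .{{_ : NonZero L}} u →
    Spaced (P ∘ f) L → # P? (applyUpTo f (u * L)) ≤ u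
  #-spaced-≤ P? f L u sp =
      s≤s⁻¹ (*-cancelˡ-< L _ _
        (subst (L * # P? (applyUpTo f (u * L)) <_) lemma (#-spaced P? f L (u * L) sp)))
    where
    lemma : u * L + L ≡ L * suc u
    lemma = trans (+-comm (u * L) L) (*-comm (suc u) L)

  -- The range is extended to start at 0, itself a hit; this extra hit pays for the end term `L`.
  #-spaced-[1⋯] : ∀ {P : ℕ → Set} (P? : Decidable P) L .{{_ : NonZero L}} n →
    P 0 → Spaced P L → L * # P? [1⋯ n ] ≤ n
  #-spaced-[1⋯] {P} P? L n p0 sp = +-cancelˡ-≤ L _ _ (s≤s⁻¹ (begin
    suc (L + L * # P? [1⋯ n ])              ≡⟨ cong suc (sym (*-suc L _)) ⟩
    suc (L * suc (# P? [1⋯ n ]))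
        ≤⟨ s≤s (*-monoʳ-≤ L (+-monoˡ-≤ (# P? [1⋯ n ]) (𝟙-true (P? 0) p0))) ⟩
    suc (L * # P? (applyUpTo id (suc n)))   ≤⟨ #-spaced P? id L (suc n) sp ⟩
    suc (n + L)                             ≡⟨ cong suc (+-comm n L) ⟩
    suc (L + n) ∎))
    where open ≤-Reasoning

  ∣-∸ : ∀ {i m n} → i ∣ m → i ∣ n → i ∣ m ∸ n
  ∣-∸ {i} (divides p refl) (divides q refl) = divides (p ∸ q) (sym (*-distribʳ-∸ i p q))

  -- Hits are at least half of `u` apart, rounded up. Twice that spacing is at least `u`, which
  -- treats both parities of `u` at once.
  #-doubles : ∀ u .{{_ : NonZero u}} D → u * # (λ k → u ∣? 2 * k) [1⋯ D ] ≤ 2 * D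
  #-doubles u@(suc _) D = begin
    u * c        ≤⟨ *-monoˡ-≤ c u≤2L ⟩
    2 * L * c    ≡⟨ *-assoc 2 L c ⟩
    2 * (L * c)  ≤⟨ *-monoʳ-≤ 2 (#-spaced-[1⋯] (λ k → u ∣? 2 * k) L D (u ∣0) sp) ⟩
    2 * D        ∎
    where
    open ≤-Reasoning
    L = ⌈ u /2⌉
    c = # (λ k → u ∣? 2 * k) [1⋯ D ]
    double : ∀ n → n + n ≡ 2 * n
    double = ℕ-solve
    u≤2L : u ≤ 2 * L
    u≤2L = begin
      u                     ≡⟨ ⌊n/2⌋+⌈n/2⌉≡n u ⟨
      ⌊ u /2⌋ + L           ≤⟨ +-monoˡ-≤ L (⌊n/2⌋≤⌈n/2⌉ u) ⟩
      L + L                 ≡⟨ double L ⟩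
      2 * L                 ∎
    sp : Spaced (λ k → u ∣ 2 * k) L
    sp i j i<j u∣2i u∣2j = begin
      ⌈ u /2⌉
        ≤⟨ ⌈n/2⌉-mono
          (∣⇒≤ {{>-nonZero (*-monoʳ-< 2 (m<n⇒0<n∸m i<j))}}
            (subst (u ∣_) (sym (*-distribˡ-∸ 2 j i)) (∣-∸ u∣2j u∣2i))) ⟩
      ⌈ 2 * (j ∸ i) /2⌉          ≡⟨ cong ⌈_/2⌉ (double (j ∸ i)) ⟨
      ⌈ (j ∸ i) + (j ∸ i) /2⌉    ≡⟨ n≡⌈n+n/2⌉ (j ∸ i) ⟨
      j ∸ i ∎

  -- Square divisors of a and square roots of zero

  coprime-divisor² : ∀ {m n k} → Coprime m n → m ∣ k * (n * n) → m ∣ k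
  coprime-divisor² {m} {n} {k} cop m∣ =
    coprime-divisor cop (coprime-divisor cop (subst (m ∣_) (lemma k n) m∣))
    where
    lemma : ∀ k n → k * (n * n) ≡ n * (n * k)
    lemma = ℕ-solve

  -- The factor `m` is removed one copy at a time: coprimality gives `m ∣ k`, and after cancelling
  -- `m` the same argument applies to the cofactor.
  coprime-square-divisor : ∀ {m n k} .{{_ : NonZero m}} → Coprime m n → m * m ∣ k * (n * n) → m * m ∣ k
  coprime-square-divisor {m} {n} {k} cop m²∣ with coprime-divisor² {k = k} cop (∣-trans (m∣m*n m) m²∣)
  ... | divides q refl =
      *-monoˡ-∣ m (coprime-divisor² {k = q} cop (*-cancelˡ-∣ m (subst (m * m ∣_) (lemma q m n) m²∣)))
    where
    lemma : ∀ q m n → q * m * (n * n) ≡ m * (q * (n * n))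
    lemma = ℕ-solve

  -- If `h` did not divide `r`, their least common multiple would be a larger number whose square
  -- divides `a`. With `g` the gcd, cancelling `g * g` leaves `h′ * h′ ∣ q * (r′ * r′)`, and `h′` is
  -- coprime to `r′`, so `h′ * h′` divides `q`, the cofactor of `r * r` in `a`.
  square-∣⇒∣ : ∀ {a r h} .{{_ : NonZero a}} → IsLargestSquareDivisorRoot a r → h * h ∣ a → h ∣ r
  square-∣⇒∣ {a} {r} {h} (r²∣a , max) h²∣a = subst (_∣ r) g≡h (gcd[m,n]∣n h r)
    where
    factor-nonZero : ∀ {k} → k * k ∣ a → NonZero k
    factor-nonZero {zero}  0∣a = contradiction (0∣⇒≡0 0∣a) (≢-nonZero⁻¹ a)
    factor-nonZero {suc _} _   = _
    instance
      r≢0 : NonZero r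
      r≢0 = factor-nonZero r²∣a
      h≢0 : NonZero h
      h≢0 = factor-nonZero h²∣a
      g≢0 : NonZero (gcd h r)
      g≢0 = ≢-nonZero (gcd[m,n]≢0 h r (inj₁ (≢-nonZero⁻¹ h)))
    g h′ r′ : ℕ
    g = gcd h r
    h′ = h / g
    r′ = r / g
    h≡ : h′ * g ≡ h
    h≡ = m/n*n≡m (gcd[m,n]∣m h r)
    r≡ : r′ * g ≡ r
    r≡ = m/n*n≡m (gcd[m,n]∣n h r)
    instance
      h′≢0 : NonZero h′
      h′≢0 = m*n≢0⇒m≢0 h′ {{subst NonZero (sym h≡) h≢0}}
      gg≢0 : NonZero (g * g)
      gg≢0 = m*n≢0 g g
    q = quotient r²∣a
    swap² : ∀ x y → x * y * (x * y) ≡ y * y * (x * x)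
    swap² = ℕ-solve
    pull : ∀ q x y → q * (x * y * (x * y)) ≡ y * y * (q * (x * x))
    pull = ℕ-solve
    a≡ : a ≡ q * (r * r)
    a≡ = m∣n⇒n≡quotient*m r²∣a
    h′²∣q : h′ * h′ ∣ q
    h′²∣q = coprime-square-divisor (coprime-/gcd h r)
      (*-cancelˡ-∣ (g * g) (subst₂ _∣_
        (trans (cong (λ z → z * z) (sym h≡)) (swap² h′ g))
        (trans a≡ (trans (cong (λ z → q * (z * z)) (sym r≡)) (pull q r′ g)))
        h²∣a))
    -- `h′ * r` is the least common multiple of `h` and `r`; maximality of `r` forces `h′` to be 1.
    h′r≤r : h′ * r ≤ r
    h′r≤r = max (h′ * r) (subst₂ _∣_ (lemma h′ r) (sym a≡) (*-monoˡ-∣ (r * r) h′²∣q))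
      where
      lemma : ∀ x y → x * x * (y * y) ≡ x * y * (x * y)
      lemma = ℕ-solve
    h′≡1 : h′ ≡ 1
    h′≡1 = ≤-antisym (*-cancelʳ-≤ h′ 1 r (subst (h′ * r ≤_) (sym (*-identityˡ r)) h′r≤r))
        (>-nonZero⁻¹ h′)
    g≡h : g ≡ h
    g≡h = trans (sym (*-identityˡ g)) (trans (cong (_* g) (sym h′≡1)) h≡)

  ∑-id : ∀ xs → ∑ xs id ≡ sum xs
  ∑-id []       = refl
  ∑-id (x ∷ xs) = cong (λ s → x + s) (∑-id xs)

  ∣-*-gcd : ∀ {a} c m n → a ∣ c * m → a ∣ c * n → a ∣ c * gcd m n
  ∣-*-gcd {a} c m n a∣cm a∣cn =
      subst (a ∣_) (sym (c*gcd[m,n]≡gcd[cm,cn] c m n)) (gcd-greatest a∣cm a∣cn)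

  -- h = a / gcd(x, a).
  ∣-square-split : ∀ {a x} .{{_ : NonZero a}} → a ∣ x * x → ∃[ h ] (h * h ∣ a × a ∣ h * x)
  ∣-square-split {a} {x} a∣x² =
      h , subst (h * h ∣_) a≡ (*-monoʳ-∣ h h∣g) , subst (_∣ h * x) a≡ (*-monoʳ-∣ h (gcd[m,n]∣m x a))
    where
    g h : ℕ
    g = gcd x a
    h = quotient (gcd[m,n]∣n x a)
    a≡ : h * g ≡ a
    a≡ = sym (m∣n⇒n≡quotient*m (gcd[m,n]∣n x a))
    instance
      g≢0 : NonZero g
      g≢0 = ≢-nonZero (gcd[m,n]≢0 x a (inj₂ (≢-nonZero⁻¹ a)))
    -- `a` divides both `x * x` and `x * a`, hence `x * g`. Cancelling `g` from `h * g ∣ x * g`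
    -- gives `h ∣ x`.
    h∣g : h ∣ g
    h∣g = gcd-greatest {x} {a}
      (*-cancelʳ-∣ g (subst (_∣ x * g) (sym a≡) (∣-*-gcd x x a a∣x² (n∣m*n x))))
      (divides g (trans (sym a≡) (*-comm h g)))

  -- With `a` written as `m * h`, the condition says `m ∣ x`, and the multiples of `m` up to `m * h`
  -- are `h` in number.
  #-multiples : ∀ a h .{{_ : NonZero a}} → h ∣ a → # (λ x → a ∣? h * x) [1⋯ a ] ≤ h
  #-multiples a h (divides m refl) =
      *-cancelˡ-≤ m (#-spaced-[1⋯] (λ x → m * h ∣? h * x) m (m * h) ((m * h) ∣*0) sp)
    where
    instance
      m≢0 : NonZero m
      m≢0 = m*n≢0⇒m≢0 m
      h≢0 : NonZero h
      h≢0 = m*n≢0⇒n≢0 m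
    _∣*0 : ∀ n → n ∣ h * 0
    n ∣*0 = subst (n ∣_) (sym (*-zeroʳ h)) (n ∣0)
    cancel : ∀ {x} → m * h ∣ h * x → m ∣ x
    cancel {x} d = *-cancelˡ-∣ h (subst (_∣ h * x) (*-comm m h) d)
    sp : Spaced (λ x → m * h ∣ h * x) m
    sp i j i<j di dj = ∣⇒≤ {{>-nonZero (m<n⇒0<n∸m i<j)}} (∣-∸ (cancel dj) (cancel di))

  #-nilpotent-squares : ∀ {a r} .{{_ : NonZero a}} → IsLargestSquareDivisorRoot a r →
    # (λ x → a ∣? x * x) [1⋯ a ] ≤ σ r
  #-nilpotent-squares {a} {r} isRoot = begin
    # (λ x → a ∣? x * x) [1⋯ a ]                          ≤⟨ ∑-mono [1⋯ a ] (λ _ → cover _) ⟩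
    ∑ [1⋯ a ] (λ x → ∑ (divisors r) λ h → 𝟙 (a ∣? h * x))
        ≡⟨ ∑-swap [1⋯ a ] (divisors r) (λ x h → 𝟙 (a ∣? h * x)) ⟩
    ∑ (divisors r) (λ h → # (λ x → a ∣? h * x) [1⋯ a ])
        ≤⟨ ∑-mono (divisors r) (λ h∈ → #-multiples a _ (divides-a (divisors-∣ {r} h∈))) ⟩
    ∑ (divisors r) id                                     ≡⟨ ∑-id (divisors r) ⟩
    σ r                                                   ∎
    where
    open ≤-Reasoning
    divides-a : ∀ {h} → h ∣ r → h ∣ a
    divides-a h∣r = ∣-trans h∣r (∣-trans (m∣m*n r) (proj₁ isRoot))
    instance
      r≢0 : NonZero r
      r≢0 = >-nonZero (proj₂ isRoot 1 (1∣ a))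
    cover : ∀ x → 𝟙 (a ∣? x * x) ≤ ∑ (divisors r) λ h → 𝟙 (a ∣? h * x)
    cover x = 𝟙-∑ (a ∣? x * x) (λ h → a ∣? h * x) λ a∣x² →
      let (h , h²∣a , a∣hx) = ∣-square-split {a} {x} a∣x² in h , ∈-divisors (square-∣⇒∣ isRoot h²∣a) , a∣hx

  -- Square roots of a nonzero residue

  ∣-*-split : ∀ {a} .{{_ : NonZero a}} s t → + a ∣ᶻ s ℤ.* t →
              ∃[ g ] (g ∣ a × + g ∣ᶻ s × + a ∣ᶻ + g ℤ.* t)
  ∣-*-split {a} s t a∣st = g , gcd[m,n]∣n ℤ.∣ s ∣ a , ∣⇒∣ᶻ (gcd[m,n]∣m ℤ.∣ s ∣ a) ,
    ∣⇒∣ᶻ (subst (a ∣_) (trans (*-comm ℤ.∣ t ∣ g) (sym (ℤ.abs-* (+ g) t)))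
      (∣-*-gcd ℤ.∣ t ∣ ℤ.∣ s ∣ a (subst (a ∣_) (trans (ℤ.abs-* s t) (*-comm ℤ.∣ s ∣ _)) (∣ᶻ⇒∣ a∣st))
        (n∣m*n ℤ.∣ t ∣)))
    where g = gcd ℤ.∣ s ∣ a

  -- For `a ≡ g * h` the second condition is `h ∣ x + y` scaled by `g`, which avoids naming the
  -- cofactor.
  Split : ℕ → ℤ → ℕ → ℕ → Set
  Split a y g x = (+ g ∣ᶻ + x ℤ.- y) × (+ a ∣ᶻ + g ℤ.* (+ x ℤ.+ y))

  split? : ∀ a y g → Decidable (Split a y g)
  split? a y g x = (+ g ∣ᶻ? _) ×-dec (+ a ∣ᶻ? _)

  sameSquare-split : ∀ {a y K x} .{{_ : NonZero a}} → + a ∣ᶻ y ℤ.* y ℤ.- K → + a ∣ᶻ + x ℤ.* + x ℤ.- K →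
    ∃[ g ] (g ∣ a × Split a y g x)
  sameSquare-split {a} {y} {K} {x} dy dx =
    ∣-*-split (+ x ℤ.- y) (+ x ℤ.+ y) (subst (+ a ∣ᶻ_) (lemma (+ x) y K) (∣m∣n⇒∣ᶻm-n dx dy))
    where
    lemma : ∀ x y K → (x ℤ.* x ℤ.- K) ℤ.- (y ℤ.* y ℤ.- K) ≡ (x ℤ.- y) ℤ.* (x ℤ.+ y)
    lemma = ℤ-solve

  pos-∸ : ∀ {i j} → i < j → + (j ∸ i) ≡ + j ℤ.- + i
  pos-∸ {i} {j} i<j = sym (trans (ℤ.m-n≡m⊖n j i) (ℤ.⊖-≥ (<⇒≤ i<j)))

  -- Two solutions differ by a multiple of both `g` and `h`, hence of `lcm g h`. Since `g * h` is
  -- `gcd g h * lcm g h`, the range consists of exactly `gcd g h` periods.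
  #-split-≤ : ∀ a y g h .{{_ : NonZero a}} → a ≡ g * h → # (split? a y g) [1⋯ a ] ≤ gcd g h
  #-split-≤ a y g h refl = subst (λ n → # (split? a y g) [1⋯ n ] ≤ gcd g h) (gcd*lcm g h)
    (#-spaced-≤ (split? a y g) suc (lcm g h) (gcd g h) sp)
    where
    instance
      g≢0 : NonZero g
      g≢0 = m*n≢0⇒m≢0 g
      L≢0 : NonZero (lcm g h)
      L≢0 = m*n≢0⇒n≢0
        (gcd g h) {{subst NonZero (sym (gcd*lcm g h)) (m*n≢0 g h {{g≢0}} {{m*n≢0⇒n≢0 g {h}}})}}
    sub : ∀ x x′ y → (x ℤ.- y) ℤ.- (x′ ℤ.- y) ≡ x ℤ.- x′
    sub = ℤ-solve
    sub′ : ∀ g x x′ y → g ℤ.* (x ℤ.+ y) ℤ.- g ℤ.* (x′ ℤ.+ y) ≡ g ℤ.* (x ℤ.- x′)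
    sub′ = ℤ-solve
    sp : Spaced (Split a y g ∘ suc) (lcm g h)
    sp i j i<j (gi , ai) (gj , aj) = ∣⇒≤ {{>-nonZero (m<n⇒0<n∸m i<j)}} (lcm-least
      (∣ᶻ⇒∣ (subst (+ g ∣ᶻ_) (trans (sub (+ suc j) (+ suc i) y) (sym (pos-∸ (s≤s i<j))))
        (∣m∣n⇒∣ᶻm-n gj gi)))
      (*-cancelˡ-∣ g (subst (g * h ∣_) (ℤ.abs-* (+ g) (+ (j ∸ i)))
        (∣ᶻ⇒∣ (subst (+ (g * h) ∣ᶻ_)
          (trans (sub′ (+ g) (+ suc j) (+ suc i) y) (cong (+ g ℤ.*_) (sym (pos-∸ (s≤s i<j)))))
            (∣m∣n⇒∣ᶻm-n aj ai))))))

  -- The gcd divides both x - y and x + y, hence 2y. It also divides `a`, hence y² - K, and 2K = y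
  -- (2y) - 2 (y² - K).
  split⇒gcd-∣ : ∀ a y g h x K .{{_ : NonZero a}} → a ≡ g * h → + a ∣ᶻ y ℤ.* y ℤ.- K → Split a y g x →
    gcd g h ∣ 2 * ℤ.∣ K ∣
  split⇒gcd-∣ a y g h x K refl dy (gx , ax) = subst (u ∣_) (ℤ.abs-* (+ 2) K) (∣ᶻ⇒∣ u∣2K)
    where
    instance
      g≢0 : NonZero g
      g≢0 = m*n≢0⇒m≢0 g
    u = gcd g h
    u∣g : + u ∣ᶻ + g
    u∣g = ∣⇒∣ᶻ (gcd[m,n]∣m g h)
    h∣ : + h ∣ᶻ + x ℤ.+ y
    h∣ = *-cancelˡ-∣ᶻ (+ g) (subst (_∣ᶻ + g ℤ.* (+ x ℤ.+ y)) (ℤ.pos-* g h) ax)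
    lemma₁ : ∀ x y → (x ℤ.+ y) ℤ.- (x ℤ.- y) ≡ + 2 ℤ.* y
    lemma₁ = ℤ-solve
    lemma₂ : ∀ y K → y ℤ.* (+ 2 ℤ.* y) ℤ.- + 2 ℤ.* (y ℤ.* y ℤ.- K) ≡ + 2 ℤ.* K
    lemma₂ = ℤ-solve
    u∣2y : + u ∣ᶻ + 2 ℤ.* y
    u∣2y = subst (+ u ∣ᶻ_) (lemma₁ (+ x) y)
        (∣m∣n⇒∣ᶻm-n (∣ᶻ-trans (∣⇒∣ᶻ (gcd[m,n]∣n g h)) h∣) (∣ᶻ-trans u∣g gx))
    u∣2K : + u ∣ᶻ + 2 ℤ.* K
    u∣2K = subst (+ u ∣ᶻ_) (lemma₂ y K) (∣m∣n⇒∣ᶻm-n (∣n⇒∣ᶻm*n y u∣2y)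
      (∣n⇒∣ᶻm*n (+ 2) (∣ᶻ-trans (∣ᶻ-trans u∣g (∣⇒∣ᶻ (m∣m*n h))) dy)))

  -- The reference root `y` must depend on `K` alone, so that all roots `x` are compared with the
  -- same one. When `K` is not a square modulo `a`, the value `+ 0` is a placeholder.
  root : ∀ a K → ∃[ y ] (∀ x → + a ∣ᶻ x ℤ.* x ℤ.- K → + a ∣ᶻ y ℤ.* y ℤ.- K)
  root a K with em {∃[ y ] (+ a ∣ᶻ y ℤ.* y ℤ.- K)}
  ... | yes (y , dy) = y , λ _ _ → dy
  ... | no  ∄y       = + 0 , λ x dx → contradiction (x , dx) ∄y

  squareRoot? : ∀ a K → Decidable (λ x → + a ∣ᶻ + x ℤ.* + x ℤ.- K)
  squareRoot? a K x = + a ∣ᶻ? _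

  -- `K` is a parameter so that positive and negative residues share one proof.
  #-squareRoots : ∀ a .{{_ : NonZero a}} D (K : ℕ → ℤ) → (∀ k → ℤ.∣ K k ∣ ≡ k) →
    ∑ [1⋯ D ] (λ k → # (squareRoot? a (K k)) [1⋯ a ]) ≤ 2 * D * d a
  #-squareRoots a D K ∣K∣ = begin
    ∑ [1⋯ D ] (λ k → # (squareRoot? a (K k)) [1⋯ a ])
      ≤⟨ ∑-mono [1⋯ D ] (λ {k} _ → per-residue k) ⟩
    ∑ [1⋯ D ] (λ k → ∑ (divisors a) (N k))
      ≡⟨ ∑-swap [1⋯ D ] (divisors a) N ⟩
    ∑ (divisors a) (λ g → ∑ [1⋯ D ] (λ k → N k g))
      ≤⟨ ∑-mono (divisors a) (λ g∈ → per-divisor _ (divisors-∣ {a} g∈)) ⟩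
    ∑ (divisors a) (λ _ → 2 * D)
      ≡⟨ ∑-const (2 * D) (divisors a) ⟩
    2 * D * d a ∎
    where
    open ≤-Reasoning
    solves : ℕ → ℕ → Set
    solves k x = + a ∣ᶻ + x ℤ.* + x ℤ.- K k
    y : ℕ → ℤ
    y k = proj₁ (root a (K k))
    -- Keeping `solves k x` beside `Split` certifies that `y k` is a genuine root and not the
    -- placeholder, as `split⇒gcd-∣` requires.
    N′? : ∀ k g → Decidable (λ x → solves k x × Split a (y k) g x)
    N′? k g x = squareRoot? a (K k) x ×-dec split? a (y k) g x
    N : ℕ → ℕ → ℕ
    N k g = # (N′? k g) [1⋯ a ]
    cover : ∀ k x → 𝟙 (squareRoot? a (K k) x) ≤ ∑ (divisors a) (λ g → 𝟙 (N′? k g x))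
    cover k x = 𝟙-∑ (squareRoot? a (K k) x) (λ g → N′? k g x) λ dx →
      let (g , g∣a , sp) = sameSquare-split {a} {y k} {K k} (proj₂ (root a (K k)) (+ x) dx) dx
      in g , ∈-divisors g∣a , dx , sp
    per-residue : ∀ k → # (squareRoot? a (K k)) [1⋯ a ] ≤ ∑ (divisors a) (N k)
    per-residue k = begin
      # (squareRoot? a (K k)) [1⋯ a ] ≤⟨ ∑-mono [1⋯ a ] (λ {x} _ → cover k x) ⟩
      ∑ [1⋯ a ] (λ x → ∑ (divisors a) (λ g → 𝟙 (N′? k g x)))
        ≡⟨ ∑-swap [1⋯ a ] (divisors a) (λ x g → 𝟙 (N′? k g x)) ⟩
      ∑ (divisors a) (N k) ∎
    per-divisor : ∀ g → g ∣ a → ∑ [1⋯ D ] (λ k → N k g) ≤ 2 * D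
    per-divisor g (divides h a≡hg) = begin
      ∑ [1⋯ D ] (λ k → N k g)
        ≤⟨ ∑-mono [1⋯ D ] (λ {k} _ → N-bound k) ⟩
      ∑ [1⋯ D ] (λ k → u * 𝟙 (u ∣? 2 * k))
        ≡⟨ ∑-* u [1⋯ D ] (λ k → 𝟙 (u ∣? 2 * k)) ⟩
      u * # (λ k → u ∣? 2 * k) [1⋯ D ]
        ≤⟨ #-doubles u D ⟩
      2 * D ∎
      where
      a≡gh : a ≡ g * h
      a≡gh = trans a≡hg (*-comm h g)
      u : ℕ
      u = gcd g h
      instance
        u≢0 : NonZero u
        u≢0 = ≢-nonZero λ u≡0 → ≢-nonZero⁻¹ a (trans a≡gh (cong (_* h) (gcd[m,n]≡0⇒m≡0 {g} {h} u≡0)))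
      N-bound : ∀ k → N k g ≤ u * 𝟙 (u ∣? 2 * k)
      N-bound k = begin
        N k g
          -- The indicator of `u ∣ 2 * k` does not involve `x`: it factors out of the count and
          -- survives to be summed over `k`.
          ≤⟨ ∑-mono [1⋯ a ] (λ {x} _ → 𝟙-* (N′? k g x) (u ∣? 2 * k) (split? a (y k) g x) (λ (dx , sp) →
               subst (λ n → u ∣ 2 * n) (∣K∣ k)
                 (split⇒gcd-∣ a (y k) g h x (K k) a≡gh (proj₂ (root a (K k)) (+ x) dx) sp) , sp)) ⟩
        ∑ [1⋯ a ] (λ x → 𝟙 (u ∣? 2 * k) * 𝟙 (split? a (y k) g x))
          ≡⟨ ∑-* (𝟙 (u ∣? 2 * k)) [1⋯ a ] (λ x → 𝟙 (split? a (y k) g x)) ⟩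
        𝟙 (u ∣? 2 * k) * # (split? a (y k) g) [1⋯ a ]
          ≤⟨ *-monoʳ-≤ (𝟙 (u ∣? 2 * k)) (#-split-≤ a (y k) g h a≡gh) ⟩
        𝟙 (u ∣? 2 * k) * u
          ≡⟨ *-comm _ u ⟩
        u * 𝟙 (u ∣? 2 * k) ∎

  -- All residues of absolute value at most D

  #-nearSquares : ∀ {a r} .{{_ : NonZero a}} → IsLargestSquareDivisorRoot a r →
      ∀ D {P : ℕ → Set} (P? : Decidable P) →
    (∀ x → P x → ∃[ n ] (ℤ.∣ + (x * x) ℤ.- n ℤ.* + a ∣ ≤ D)) →
    length (filter P? [1⋯ a ]) ≤ 4 * (D * d a) + σ r
  #-nearSquares {a} {r} isRoot D {P} P? near = begin
    length (filter P? [1⋯ a ])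
      ≡⟨ length-filter P? [1⋯ a ] ⟩
    # P? [1⋯ a ]
      ≤⟨ ∑-mono [1⋯ a ] (λ {x} _ → cover x) ⟩
    ∑ [1⋯ a ] (λ x → 𝟙 (a ∣? x * x) + (S⁺ x + S⁻ x))
      ≡⟨ ∑-+ [1⋯ a ] (λ x → 𝟙 (a ∣? x * x)) (λ x → S⁺ x + S⁻ x) ⟩
    # (λ x → a ∣? x * x) [1⋯ a ] + ∑ [1⋯ a ] (λ x → S⁺ x + S⁻ x)
      ≡⟨ cong (λ s → # (λ x → a ∣? x * x) [1⋯ a ] + s) (∑-+ [1⋯ a ] S⁺ S⁻) ⟩
    # (λ x → a ∣? x * x) [1⋯ a ] + (∑ [1⋯ a ] S⁺ + ∑ [1⋯ a ] S⁻)
      ≤⟨ +-mono-≤ (#-nilpotent-squares isRoot) (+-mono-≤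
           (signed (λ k → + k) (λ _ → refl)) (signed (λ k → ℤ.- + k) (λ k → ℤ.∣-i∣≡∣i∣ (+ k)))) ⟩
    σ r + (2 * D * d a + 2 * D * d a)
      ≡⟨ lemma (σ r) D (d a) ⟩
    4 * (D * d a) + σ r ∎
    where
    open ≤-Reasoning
    lemma : ∀ s D d → s + (2 * D * d + 2 * D * d) ≡ 4 * (D * d) + s
    lemma = ℕ-solve
    S : (ℕ → ℤ) → ℕ → ℕ
    S K x = ∑ [1⋯ D ] (λ k → 𝟙 (squareRoot? a (K k) x))
    S⁺ S⁻ : ℕ → ℕ
    S⁺ = S (λ k → + k)
    S⁻ = S (λ k → ℤ.- + k)
    signed : ∀ K → (∀ k → ℤ.∣ K k ∣ ≡ k) → ∑ [1⋯ a ] (S K) ≤ 2 * D * d a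
    signed K ∣K∣ = subst (_≤ 2 * D * d a) (∑-swap [1⋯ D ] [1⋯ a ] (λ k x → 𝟙 (squareRoot? a (K k) x)))
      (#-squareRoots a D K ∣K∣)
    congruent : ∀ x n k → + (x * x) ℤ.- n ℤ.* + a ≡ k → + a ∣ᶻ + x ℤ.* + x ℤ.- k
    congruent x n k refl =
        dividesᶻ n (trans (cong (λ s → s ℤ.- (+ (x * x) ℤ.- n ℤ.* + a)) (sym (ℤ.pos-* x x)))
          (cancel (+ (x * x)) (n ℤ.* + a)))
      where
      cancel : ∀ s t → s ℤ.- (s ℤ.- t) ≡ t
      cancel = ℤ-solve
    hit : ∀ x n K k → + (x * x) ℤ.- n ℤ.* + a ≡ K k → 1 ≤ k → k ≤ D → 1 ≤ S K x
    hit x n K k eq 1≤k k≤D = ≤-trans (𝟙-true (squareRoot? a (K k) x) (congruent x n (K k) eq))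
      (∈⇒≤∑ (λ k → 𝟙 (squareRoot? a (K k) x)) (∈-[1⋯] 1≤k k≤D))
    zero-residue : ∀ x n → + (x * x) ℤ.- n ℤ.* + a ≡ + 0 → a ∣ x * x
    zero-residue x n eq =
        ∣ᶻ⇒∣ (subst (+ a ∣ᶻ_) (trans (ℤ.+-identityʳ _) (sym (ℤ.pos-* x x))) (congruent x n (+ 0) eq))
    cover : ∀ x → 𝟙 (P? x) ≤ 𝟙 (a ∣? x * x) + (S⁺ x + S⁻ x)
    cover x with P? x
    ... | no _ = z≤n
    ... | yes p with near x p
    ...   | n , k≤D with + (x * x) ℤ.- n ℤ.* + a in eq
    ...     | + zero    = ≤-trans (𝟙-true (a ∣? x * x) (zero-residue x n eq)) (m≤m+n _ (S⁺ x + S⁻ x))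
    ...     | + suc k   =
        ≤-trans (hit x n (λ k → + k) (suc k) eq (s≤s z≤n) k≤D)
          (≤-trans (m≤m+n (S⁺ x) (S⁻ x)) (m≤n+m _ (𝟙 (a ∣? x * x))))
    ...     | -[1+ k ]  =
        ≤-trans (hit x n (λ k → ℤ.- + k) (suc k) eq (s≤s z≤n) k≤D)
          (≤-trans (m≤n+m (S⁻ x) (S⁺ x)) (m≤n+m _ (𝟙 (a ∣? x * x))))

module RealAnalysis (em : ExcludedMiddle 0ℓ) (R : CompleteOrderedField) where

  open Counting em using (#-nearSquares)
  open Analysis em R
  open CompleteOrderedField R
    using (isCommutativeRing; 0≉1; *-inverseʳ; isTotalOrder; +-monoʳ-≤; *-nonNeg; complete; UpperBound)

  -- Integers inside the ordered field

  ℝ-ring : CommutativeRing 0ℓ 0ℓ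
  ℝ-ring = record { isCommutativeRing = isCommutativeRing }

  open CommutativeRing ℝ-ring
    using (+-cong; +-congˡ; +-congʳ; +-comm; +-assoc; +-identityˡ; +-identityʳ; *-cong; *-congˡ; *-congʳ; *-comm;
           *-assoc; *-identityˡ; *-identityʳ; zeroˡ; zeroʳ; distribʳ; -‿cong; -‿inverseˡ; refl; sym;
           trans; reflexive)
  open Algebra.Properties.Ring (CommutativeRing.ring ℝ-ring)
    using (-‿distribˡ-*; -‿distribʳ-*; -‿involutive; -0#≈0#)
  open Algebra.Properties.AbelianGroup (CommutativeRing.+-abelianGroup ℝ-ring) using (⁻¹-∙-comm)
  open IsTotalOrder isTotalOrder using (antisym; total; isPartialOrder)
    renaming (refl to ≤-refl; reflexive to ≤-reflexive; trans to ≤-trans)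

  ℝ-poset : Poset 0ℓ 0ℓ 0ℓ
  ℝ-poset = record { isPartialOrder = isPartialOrder }

  module ≤-Reasoning = Relation.Binary.Reasoning.PartialOrder ℝ-poset

  fromℕ-+ : ∀ m n → fromℕ (m ℕ.+ n) ≈ fromℕ m + fromℕ n
  fromℕ-+ zero    n = sym (+-identityˡ _)
  fromℕ-+ (suc m) n = trans (+-congˡ (fromℕ-+ m n)) (sym (+-assoc _ _ _))

  fromℕ-* : ∀ m n → fromℕ (m ℕ.* n) ≈ fromℕ m * fromℕ n
  fromℕ-* zero    n = sym (zeroˡ _)
  fromℕ-* (suc m) n = begin-equality
    fromℕ (n ℕ.+ m ℕ.* n)                ≈⟨ fromℕ-+ n (m ℕ.* n) ⟩
    fromℕ n + fromℕ (m ℕ.* n)            ≈⟨ +-cong (sym (*-identityˡ _)) (fromℕ-* m n) ⟩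
    1# * fromℕ n + fromℕ m * fromℕ n     ≈⟨ distribʳ _ _ _ ⟨
    (1# + fromℕ m) * fromℕ n             ∎
    where open ≤-Reasoning

  fromℤ-neg : ∀ i → fromℤ (ℤ.- i) ≈ - fromℤ i
  fromℤ-neg (+ zero)  = sym -0#≈0#
  fromℤ-neg (+ suc n) = refl
  fromℤ-neg -[1+ n ]  = sym (-‿involutive _)

  fromℤ-⊖ : ∀ m n → fromℤ (m ℤ.⊖ n) ≈ fromℕ m - fromℕ n
  fromℤ-⊖ m       zero    = sym (trans (+-congˡ -0#≈0#) (+-identityʳ _))
  fromℤ-⊖ zero    (suc n) = sym (+-identityˡ _)
  fromℤ-⊖ (suc m) (suc n) = begin-equality
    fromℤ (suc m ℤ.⊖ suc n)                  ≡⟨ ≡.cong fromℤ (ℤ.[1+m]⊖[1+n]≡m⊖n m n) ⟩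
    fromℤ (m ℤ.⊖ n)                          ≈⟨ fromℤ-⊖ m n ⟩
    fromℕ m + - fromℕ n                      ≈⟨ +-congʳ (+-identityˡ _) ⟨
    0# + fromℕ m + - fromℕ n                 ≈⟨ +-congʳ (+-congʳ (-‿inverseˡ 1#)) ⟨
    - 1# + 1# + fromℕ m + - fromℕ n          ≈⟨ +-congʳ (+-assoc _ _ _) ⟩
    - 1# + (1# + fromℕ m) + - fromℕ n        ≈⟨ +-congʳ (+-comm _ _) ⟩
    (1# + fromℕ m) + - 1# + - fromℕ n        ≈⟨ +-assoc _ _ _ ⟩
    (1# + fromℕ m) + (- 1# + - fromℕ n)      ≈⟨ +-congˡ (⁻¹-∙-comm 1# (fromℕ n)) ⟩
    (1# + fromℕ m) + - (1# + fromℕ n)        ∎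
    where open ≤-Reasoning

  fromℤ-+ : ∀ i j → fromℤ (i ℤ.+ j) ≈ fromℤ i + fromℤ j
  fromℤ-+ (+ m)    (+ n)    = fromℕ-+ m n
  fromℤ-+ (+ m)    -[1+ n ] = fromℤ-⊖ m (suc n)
  fromℤ-+ -[1+ m ] (+ n)    = trans (fromℤ-⊖ n (suc m)) (+-comm _ _)
  fromℤ-+ -[1+ m ] -[1+ n ] = trans
    (-‿cong (trans (reflexive (≡.cong (λ k → fromℕ (suc k)) (≡.sym (ℕ.+-suc m n))))
        (fromℕ-+ (suc m) (suc n))))
    (sym (⁻¹-∙-comm _ _))

  fromℤ-*ˡ : ∀ m j → fromℤ (+ m ℤ.* j) ≈ fromℕ m * fromℤ j
  fromℤ-*ˡ m (+ n)      = trans (reflexive (≡.cong fromℤ (≡.sym (ℤ.pos-* m n)))) (fromℕ-* m n)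
  fromℤ-*ˡ m -[1+ n ]   = begin-equality
    fromℤ (+ m ℤ.* (ℤ.- + suc n))   ≡⟨ ≡.cong fromℤ (ℤ.neg-distribʳ-* (+ m) (+ suc n)) ⟨
    fromℤ (ℤ.- (+ m ℤ.* + suc n))   ≈⟨ fromℤ-neg (+ m ℤ.* + suc n) ⟩
    - fromℤ (+ m ℤ.* + suc n)       ≈⟨ -‿cong (fromℤ-*ˡ m (+ suc n)) ⟩
    - (fromℕ m * fromℕ (suc n))     ≈⟨ -‿distribʳ-* _ _ ⟩
    fromℕ m * - fromℕ (suc n)       ∎
    where open ≤-Reasoning

  fromℤ-* : ∀ i j → fromℤ (i ℤ.* j) ≈ fromℤ i * fromℤ j
  fromℤ-* (+ m)    j       = fromℤ-*ˡ m j
  fromℤ-* -[1+ m ] j       = begin-equality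
    fromℤ ((ℤ.- + suc m) ℤ.* j)     ≡⟨ ≡.cong fromℤ (ℤ.neg-distribˡ-* (+ suc m) j) ⟨
    fromℤ (ℤ.- (+ suc m ℤ.* j))     ≈⟨ fromℤ-neg (+ suc m ℤ.* j) ⟩
    - fromℤ (+ suc m ℤ.* j)         ≈⟨ -‿cong (fromℤ-*ˡ (suc m) j) ⟩
    - (fromℕ (suc m) * fromℤ j)     ≈⟨ -‿distribˡ-* _ _ ⟩
    - fromℕ (suc m) * fromℤ j       ∎
    where open ≤-Reasoning

  -- Unlike fromℤ, this sends 1 to 1# on the nose, so that the ring solver
  -- can mention 1#.
  literalℕ : ℕ → ℝ
  literalℕ 0             = 0#
  literalℕ 1             = 1#
  literalℕ (suc (suc n)) = 1# + literalℕ (suc n)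

  literal : ℤ → ℝ
  literal (+ n)    = literalℕ n
  literal -[1+ n ] = - literalℕ (suc n)

  literalℕ≈fromℕ : ∀ n → literalℕ n ≈ fromℕ n
  literalℕ≈fromℕ 0             = refl
  literalℕ≈fromℕ 1             = sym (+-identityʳ 1#)
  literalℕ≈fromℕ (suc (suc n)) = +-congˡ (literalℕ≈fromℕ (suc n))

  literal≈fromℤ : ∀ i → literal i ≈ fromℤ i
  literal≈fromℤ (+ n)    = literalℕ≈fromℕ n
  literal≈fromℤ -[1+ n ] = -‿cong (literalℕ≈fromℕ (suc n))

  literal-morphism : ℤ.+-*-rawRing -Raw-AlmostCommutative⟶ fromCommutativeRing ℝ-ring
  literal-morphism = record
    { ⟦_⟧    = literal
    ; +-homo = λ i j → via (i ℤ.+ j) (fromℤ-+ i j) (+-cong (literal≈fromℤ i) (literal≈fromℤ j))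
    ; *-homo = λ i j → via (i ℤ.* j) (fromℤ-* i j) (*-cong (literal≈fromℤ i) (literal≈fromℤ j))
    ; -‿homo = λ i → via (ℤ.- i) (fromℤ-neg i) (-‿cong (literal≈fromℤ i))
    ; 0-homo = refl
    ; 1-homo = refl
    }
    where
    via : ∀ i {x y} → fromℤ i ≈ x → y ≈ x → literal i ≈ y
    via i p q = trans (literal≈fromℤ i) (trans p (sym q))

  literal≟ : ∀ i j → Maybe (literal i ≈ literal j)
  literal≟ i j with i ℤ.≟ j
  ... | yes ≡.refl = just refl
  ... | no  _      = nothing

  open Algebra.Solver.Ring ℤ.+-*-rawRing (fromCommutativeRing ℝ-ring) literal-morphism literal≟
    using (solve; _:=_; _:+_; _:*_; _:-_; :-_; con)

  -- Order and the Archimedean property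

  ≤⇒0≤ : ∀ {x y} → x ≤ y → 0# ≤ y - x
  ≤⇒0≤ {x} {y} x≤y = begin
    0#          ≈⟨ -‿inverseˡ x ⟨
    - x + x     ≤⟨ +-monoʳ-≤ (- x) x≤y ⟩
    - x + y     ≈⟨ +-comm _ _ ⟩
    y - x       ∎
    where open ≤-Reasoning

  0≤⇒≤ : ∀ {x y} → 0# ≤ y - x → x ≤ y
  0≤⇒≤ {x} {y} 0≤ = begin
    x            ≈⟨ +-identityʳ x ⟨
    x + 0#       ≤⟨ +-monoʳ-≤ x 0≤ ⟩
    x + (y - x)  ≈⟨ solve 2 (λ x y → x :+ (y :- x) := y) refl x y ⟩
    y            ∎
    where open ≤-Reasoning

  -- Inequalities are proved by exhibiting y - x as a visibly nonnegative
  -- expression, which leaves an identity to the ring solver.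
  ≤-by : ∀ {x y} z → 0# ≤ z → y - x ≈ z → x ≤ y
  ≤-by z 0≤z y-x≈z = 0≤⇒≤ (≤-trans 0≤z (≤-reflexive (sym y-x≈z)))

  +-nonNeg : ∀ {x y} → 0# ≤ x → 0# ≤ y → 0# ≤ x + y
  +-nonNeg {x} {y} 0≤x 0≤y = ≤-trans 0≤x (≤-trans (≤-reflexive (sym (+-identityʳ x))) (+-monoʳ-≤ x 0≤y))

  +-mono-≤ : ∀ {x y u v} → x ≤ y → u ≤ v → x + u ≤ y + v
  +-mono-≤ {x} {y} {u} {v} x≤y u≤v = ≤-by _ (+-nonNeg (≤⇒0≤ x≤y) (≤⇒0≤ u≤v))
    (solve 4 (λ x y u v → (y :+ v) :- (x :+ u) := (y :- x) :+ (v :- u)) refl x y u v)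

  +-monoˡ-≤ : ∀ z {x y} → x ≤ y → x + z ≤ y + z
  +-monoˡ-≤ z x≤y = +-mono-≤ x≤y ≤-refl

  neg-mono-≤ : ∀ {x y} → x ≤ y → - y ≤ - x
  neg-mono-≤ {x} {y} x≤y = ≤-by _ (≤⇒0≤ x≤y) (solve 2 (λ x y → :- x :- :- y := y :- x) refl x y)

  *-monoʳ-≤ : ∀ {z x y} → 0# ≤ z → x ≤ y → z * x ≤ z * y
  *-monoʳ-≤ {z} {x} {y} 0≤z x≤y = ≤-by _ (*-nonNeg 0≤z (≤⇒0≤ x≤y))
    (solve 3 (λ x y z → z :* y :- z :* x := z :* (y :- x)) refl x y z)

  *-monoˡ-≤ : ∀ {z x y} → 0# ≤ z → x ≤ y → x * z ≤ y * z
  *-monoˡ-≤ {z} {x} {y} 0≤z x≤y =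
      ≤-trans (≤-reflexive (*-comm x z)) (≤-trans (*-monoʳ-≤ 0≤z x≤y) (≤-reflexive (*-comm z y)))

  *-mono-≤ : ∀ {x y u v} → 0# ≤ x → x ≤ y → 0# ≤ u → u ≤ v → x * u ≤ y * v
  *-mono-≤ 0≤x x≤y 0≤u u≤v = ≤-trans (*-monoˡ-≤ 0≤u x≤y) (*-monoʳ-≤ (≤-trans 0≤x x≤y) u≤v)

  ≤-or-> : ∀ x y → x ≤ y ⊎ y < x
  ≤-or-> x y with em {x ≤ y}
  ... | yes x≤y = inj₁ x≤y
  ... | no  x≰y = inj₂ (Strict.≰⇒> _≈_ _≤_ sym ≤-reflexive total x≰y)

  <⇒≤ : ∀ {x y} → x < y → x ≤ y
  <⇒≤ = proj₁

  <⇒≱ : ∀ {x y} → x < y → ¬ (y ≤ x)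
  <⇒≱ = Strict.<⇒≱ _≈_ _≤_ antisym

  ≰⇒> : ∀ {x y} → ¬ (x ≤ y) → y < x
  ≰⇒> = Strict.≰⇒> _≈_ _≤_ sym ≤-reflexive total

  ≮⇒≥ : ∀ {x y} → ¬ (x < y) → y ≤ x
  ≮⇒≥ {x} {y} x≮y with ≤-or-> y x
  ... | inj₁ y≤x = y≤x
  ... | inj₂ x<y = contradiction x<y x≮y

  <⇒0< : ∀ {x y} → x < y → 0# < y - x
  <⇒0< {x} {y} x<y = ≰⇒> λ y-x≤0 →
      <⇒≱ x<y (≤-by _ (neg-0≤ y-x≤0) (solve 2 (λ x y → x :- y := :- (y :- x)) refl x y))
    where
    neg-0≤ : ∀ {z} → z ≤ 0# → 0# ≤ - z
    neg-0≤ z≤0 = ≤-trans (≤-reflexive (sym -0#≈0#)) (neg-mono-≤ z≤0)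

  *-integral : ∀ {x y} → ¬ (x ≈ 0#) → x * y ≈ 0# → y ≈ 0#
  *-integral {x} {y} x≉0 xy≈0 = begin-equality
    y               ≈⟨ *-identityˡ y ⟨
    1# * y          ≈⟨ *-congʳ (*-inverseʳ x x≉0) ⟨
    x * x ⁻¹ * y    ≈⟨ solve 3 (λ x i y → x :* i :* y := i :* (x :* y)) refl x (x ⁻¹) y ⟩
    x ⁻¹ * (x * y)  ≈⟨ *-congˡ xy≈0 ⟩
    x ⁻¹ * 0#       ≈⟨ zeroʳ _ ⟩
    0#              ∎
    where open ≤-Reasoning

  >⇒≉ : ∀ {x} → 0# < x → ¬ (x ≈ 0#)
  >⇒≉ (_ , 0≉x) x≈0 = 0≉x (sym x≈0)

  *-pos : ∀ {x y} → 0# < x → 0# < y → 0# < x * y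
  *-pos 0<x 0<y = *-nonNeg (<⇒≤ 0<x) (<⇒≤ 0<y) , λ 0≈xy → >⇒≉ 0<y (*-integral (>⇒≉ 0<x) (sym 0≈xy))

  +-pos-nonNeg : ∀ {x y} → 0# < x → 0# ≤ y → 0# < x + y
  +-pos-nonNeg {x} {y} 0<x 0≤y = begin-strict
    0#      <⟨ 0<x ⟩
    x       ≈⟨ +-identityʳ x ⟨
    x + 0#  ≤⟨ +-monoʳ-≤ x 0≤y ⟩
    x + y   ∎
    where open ≤-Reasoning

  square-nonNeg : ∀ x → 0# ≤ x * x
  square-nonNeg x with total 0# x
  ... | inj₁ 0≤x = *-nonNeg 0≤x 0≤x
  ... | inj₂ x≤0 =
      ≤-trans (*-nonNeg (0≤- x≤0) (0≤- x≤0))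
        (≤-reflexive (solve 1 (λ x → :- x :* :- x := x :* x) refl x))
    where
    0≤- : ∀ {x} → x ≤ 0# → 0# ≤ - x
    0≤- x≤0 = ≤-trans (≤-reflexive (sym -0#≈0#)) (neg-mono-≤ x≤0)

  0≤1 : 0# ≤ 1#
  0≤1 = ≤-trans (square-nonNeg 1#) (≤-reflexive (*-identityˡ 1#))

  0<1 : 0# < 1#
  0<1 = 0≤1 , 0≉1

  *-cancelˡ-≤ : ∀ {z x y} → 0# < z → z * x ≤ z * y → x ≤ y
  *-cancelˡ-≤ {z} {x} {y} 0<z zx≤zy = ≮⇒≥ λ y<x → <⇒≱ (*-pos 0<z (<⇒0< y<x))
    (≤-by _ (≤⇒0≤ zx≤zy)
        (solve 3 (λ x y z → con (+ 0) :- z :* (x :- y) := z :* y :- z :* x) refl x y z))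

  ⁻¹-pos : ∀ {x} → 0# < x → 0# < x ⁻¹
  ⁻¹-pos {x} 0<x = ≰⇒> λ x⁻¹≤0 → <⇒≱ 0<1 (begin
    1#         ≈⟨ *-inverseʳ x (>⇒≉ 0<x) ⟨
    x * x ⁻¹   ≤⟨ *-monoʳ-≤ (<⇒≤ 0<x) x⁻¹≤0 ⟩
    x * 0#     ≈⟨ zeroʳ x ⟩
    0#         ∎)
    where open ≤-Reasoning

  fromℕ-nonNeg : ∀ n → 0# ≤ fromℕ n
  fromℕ-nonNeg zero    = ≤-refl
  fromℕ-nonNeg (suc n) = +-nonNeg 0≤1 (fromℕ-nonNeg n)

  fromℕ-pos : ∀ n .{{_ : NonZero n}} → 0# < fromℕ n
  fromℕ-pos (suc n) = +-pos-nonNeg 0<1 (fromℕ-nonNeg n)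

  fromℕ-mono-≤ : ∀ {m n} → m ℕ.≤ n → fromℕ m ≤ fromℕ n
  fromℕ-mono-≤ {n = n} z≤n = fromℕ-nonNeg n
  fromℕ-mono-≤ (s≤s m≤n) = +-monoʳ-≤ 1# (fromℕ-mono-≤ m≤n)

  fromℕ-mono-< : ∀ {m n} → m ℕ.< n → fromℕ m < fromℕ n
  fromℕ-mono-< {m} {n} m<n = begin-strict
    fromℕ m             ≈⟨ +-identityˡ _ ⟨
    0# + fromℕ m        <⟨ +-monoˡ-≤ (fromℕ m) 0≤1 , (λ 0+m≈1+m → 0≉1 (+-cancel 0+m≈1+m)) ⟩
    fromℕ (suc m)       ≤⟨ fromℕ-mono-≤ {suc m} {n} m<n ⟩
    fromℕ n             ∎
    where
    open ≤-Reasoning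
    +-cancel : ∀ {x y z} → x + z ≈ y + z → x ≈ y
    +-cancel {x} {y} {z} p =
        trans (solve 2 (λ x z → x := x :+ z :- z) refl x z)
          (trans (+-congʳ p) (solve 2 (λ x z → x :+ z :- z := x) refl y z))

  -- If the naturals were bounded, their supremum minus one would still be an upper bound, because n
  -- + 1 is again a natural.
  archimedean : ∀ x → ∃[ n ] x ≤ fromℕ n
  archimedean x with em {∃[ n ] x ≤ fromℕ n}
  ... | yes p = p
  ... | no ¬p = contradiction u≤u-1 (<⇒≱ u-1<u)
    where
    open ≤-Reasoning
    P : ℝ → Set
    P y = ∃[ n ] y ≈ fromℕ n
    sup = complete P (0# , 0 , refl) (x , λ { y (n , y≈n) → ≤-trans (≤-reflexive y≈n) (<⇒≤ (≰⇒> λ x≤n → ¬p (n , x≤n))) })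
    u = proj₁ sup
    u≤u-1 : u ≤ u - 1#
    u≤u-1 = proj₂ (proj₂ sup) (u - 1#) λ { y (n , y≈n) → begin
      y                  ≈⟨ y≈n ⟩
      fromℕ n            ≈⟨ solve 1 (λ x → x := con (+ 1) :+ x :- con (+ 1)) refl (fromℕ n) ⟩
      fromℕ (suc n) - 1# ≤⟨ +-monoˡ-≤ (- 1#) (proj₁ (proj₂ sup) _ (suc n , refl)) ⟩
      u - 1#             ∎ }
    u-1<u : u - 1# < u
    u-1<u = ≰⇒> λ u≤ →
        <⇒≱ 0<1 (≤-by _ (≤⇒0≤ u≤)
          (solve 1 (λ u → con (+ 0) :- con (+ 1) := u :- con (+ 1) :- u) refl u))

  ≤-from-2ε : ∀ {x y} → (∀ ε → 0# < ε → x ≤ y + ε + ε) → x ≤ y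
  -- Taking ε to be a third of `x - y` leaves the last third nonpositive, a contradiction.
  ≤-from-2ε {x} {y} h = ≮⇒≥ λ y<x → <⇒≱ (*-pos 0<⅓ (<⇒0< y<x)) (bound y<x)
    where
    open ≤-Reasoning
    ⅓ = fromℕ 3 ⁻¹
    0<⅓ = ⁻¹-pos (fromℕ-pos 3)
    bound : y < x → ⅓ * (x - y) ≤ 0#
    bound y<x = ≤-by _ (≤⇒0≤ (h (⅓ * (x - y)) (*-pos 0<⅓ (<⇒0< y<x)))) (begin-equality
      0# - ⅓ * (x - y)
        ≈⟨ solve 3 (λ t x y → con (+ 0) :- t :* (x :- y) :=
          y :+ t :* (x :- y) :+ t :* (x :- y) :-
            (y :+ (con (+ 1) :+ (con (+ 1) :+ (con (+ 1) :+ con (+ 0)))) :* t :* (x :- y))) refl ⅓ x y ⟩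
      y + ⅓ * (x - y) + ⅓ * (x - y) - (y + fromℕ 3 * ⅓ * (x - y))
        ≈⟨ +-congˡ (-‿cong (+-congˡ (*-congʳ (*-inverseʳ _ (>⇒≉ (fromℕ-pos 3)))))) ⟩
      y + ⅓ * (x - y) + ⅓ * (x - y) - (y + 1# * (x - y))
        ≈⟨ solve 3 (λ t x y → y :+ t :* (x :- y) :+ t :* (x :- y) :- (y :+ con (+ 1) :* (x :- y)) :=
          y :+ t :* (x :- y) :+ t :* (x :- y) :- x) refl ⅓ x y ⟩
      y + ⅓ * (x - y) + ⅓ * (x - y) - x ∎)

  -- Definite descriptions and absolute value

  the-spec : ∀ {A : Set} {default : A} {P : A → Set} → Σ A P → P (the default P)
  the-spec {A} {_} {P} p with em {Σ A P}
  ... | yes (_ , q) = q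
  ... | no  ¬p      = contradiction p ¬p

  abs-nonNeg : ∀ {x} → 0# ≤ x → abs x ≈ x
  abs-nonNeg {x} 0≤x with em {0# ≤ x}
  ... | yes _ = refl
  ... | no ¬p = contradiction 0≤x ¬p

  abs-nonPos : ∀ {x} → x ≤ 0# → abs x ≈ - x
  abs-nonPos {x} x≤0 with em {0# ≤ x}
  ... | yes p =
      trans (antisym (≤-trans x≤0 (≤-reflexive refl)) p) (trans (sym -0#≈0#) (-‿cong (antisym p x≤0)))
  ... | no  _ = refl

  abs-≥ : ∀ x → x ≤ abs x
  abs-≥ x with em {0# ≤ x}
  ... | yes _ = ≤-refl
  ... | no ¬p = ≤-trans x≤0 (≤-trans (≤-reflexive (sym -0#≈0#)) (neg-mono-≤ x≤0))
    where
    x≤0 : x ≤ 0#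
    x≤0 = <⇒≤ (≰⇒> ¬p)

  -- The exponential series at nonnegative arguments

  -- e k y = yᵏ / k!, S N y = Σ_{k < N} e k y, and E y = eʸ for y ≥ 0.
  e : ℕ → ℝ → ℝ
  e zero    y = 1#
  e (suc k) y = e k y * (y * fromℕ (suc k) ⁻¹)

  e-rec : ∀ k y → fromℕ (suc k) * e (suc k) y ≈ y * e k y
  e-rec k y = begin-equality
    n * (e k y * (y * n ⁻¹))
        ≈⟨ solve 4 (λ n i e y → n :* (e :* (y :* i)) := n :* i :* (y :* e)) refl n (n ⁻¹) (e k y) y ⟩
    n * n ⁻¹ * (y * e k y)     ≈⟨ *-congʳ (*-inverseʳ n (>⇒≉ (fromℕ-pos (suc k)))) ⟩
    1# * (y * e k y)           ≈⟨ *-identityˡ _ ⟩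
    y * e k y                  ∎
    where
    open ≤-Reasoning
    n = fromℕ (suc k)

  e-cong : ∀ k {x y} → x ≈ y → e k x ≈ e k y
  e-cong zero    x≈y = refl
  e-cong (suc k) x≈y = *-cong (e-cong k x≈y) (*-congʳ x≈y)

  e-nonNeg : ∀ k {y} → 0# ≤ y → 0# ≤ e k y
  e-nonNeg zero    0≤y = 0≤1
  e-nonNeg (suc k) 0≤y = *-nonNeg (e-nonNeg k 0≤y) (*-nonNeg 0≤y (<⇒≤ (⁻¹-pos (fromℕ-pos (suc k)))))

  e-mono : ∀ k {x y} → 0# ≤ x → x ≤ y → e k x ≤ e k y
  e-mono zero    0≤x x≤y = ≤-refl
  e-mono (suc k) 0≤x x≤y = *-mono-≤ (e-nonNeg k 0≤x) (e-mono k 0≤x x≤y)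
    (*-nonNeg 0≤x 0≤n⁻¹) (*-monoˡ-≤ 0≤n⁻¹ x≤y)
    where
    0≤n⁻¹ = <⇒≤ (⁻¹-pos (fromℕ-pos (suc k)))

  -- A mean value inequality, as `e k` is the derivative of `e (suc k)`. In the induction both sides
  -- are multiplied by k + 2; `e-rec` then splits the left side into parts bounded by 1 and k + 1
  -- copies of (y - x) e (k + 1) y.
  e-lipschitz : ∀ k {x y} → 0# ≤ x → x ≤ y → e (suc k) y - e (suc k) x ≤ (y - x) * e k y
  e-lipschitz zero {x} {y} 0≤x x≤y = ≤-reflexive (trans
    (solve 3 (λ x y i → con (+ 1) :* (y :* i) :- con (+ 1) :* (x :* i) := (y :- x) :* i)
        refl x y (fromℕ 1 ⁻¹))
    (*-congˡ (trans (sym (*-identityˡ _))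
        (trans (*-congʳ (sym (+-identityʳ 1#))) (*-inverseʳ (fromℕ 1) (>⇒≉ (fromℕ-pos 1)))))))
  e-lipschitz (suc k) {x} {y} 0≤x x≤y = *-cancelˡ-≤ (fromℕ-pos (suc (suc k))) (begin
    n * (e (2 ℕ.+ k) y - e (2 ℕ.+ k) x)
      ≈⟨ solve 3 (λ n p q → n :* (p :- q) := n :* p :- n :* q) refl n _ _ ⟩
    n * e (2 ℕ.+ k) y - n * e (2 ℕ.+ k) x
      ≈⟨ +-cong (e-rec (suc k) y) (-‿cong (e-rec (suc k) x)) ⟩
    y * e (suc k) y - x * e (suc k) x
      ≈⟨ solve 4 (λ x y p q → y :* p :- x :* q := (y :- x) :* p :+ x :* (p :- q)) refl x y _ _ ⟩
    (y - x) * e (suc k) y + x * (e (suc k) y - e (suc k) x)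
      ≤⟨ +-monoʳ-≤ _ (*-monoʳ-≤ 0≤x (e-lipschitz k 0≤x x≤y)) ⟩
    (y - x) * e (suc k) y + x * ((y - x) * e k y)
      ≤⟨ +-monoʳ-≤ _ (*-monoˡ-≤ (*-nonNeg (≤⇒0≤ x≤y) (e-nonNeg k 0≤y)) x≤y) ⟩
    (y - x) * e (suc k) y + y * ((y - x) * e k y)
      ≈⟨ solve 4 (λ x y p q → (y :- x) :* p :+ y :* ((y :- x) :* q) :=
        (y :- x) :* p :+ (y :- x) :* (y :* q)) refl x y _ _ ⟩
    (y - x) * e (suc k) y + (y - x) * (y * e k y)
      ≈⟨ +-congˡ (*-congˡ (e-rec k y)) ⟨
    (y - x) * e (suc k) y + (y - x) * (fromℕ (suc k) * e (suc k) y)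
      ≈⟨ solve 4 (λ x y p m → (y :- x) :* p :+ (y :- x) :* (m :* p) :=
        (con (+ 1) :+ m) :* ((y :- x) :* p)) refl x y _ _ ⟩
    n * ((y - x) * e (suc k) y) ∎)
    where
    open ≤-Reasoning
    n = fromℕ (suc (suc k))
    0≤y = ≤-trans 0≤x x≤y

  S : ℕ → ℝ → ℝ
  S zero    y = 0#
  S (suc N) y = S N y + e N y

  S-cong : ∀ N {x y} → x ≈ y → S N x ≈ S N y
  S-cong zero    x≈y = refl
  S-cong (suc N) x≈y = +-cong (S-cong N x≈y) (e-cong N x≈y)

  S-mono : ∀ N {x y} → 0# ≤ x → x ≤ y → S N x ≤ S N y
  S-mono zero    0≤x x≤y = ≤-refl
  S-mono (suc N) 0≤x x≤y = +-mono-≤ (S-mono N 0≤x x≤y) (e-mono N 0≤x x≤y)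

  S-step : ∀ N {y} → 0# ≤ y → S N y ≤ S (suc N) y
  S-step N {y} 0≤y = ≤-trans (≤-reflexive (sym (+-identityʳ _))) (+-monoʳ-≤ (S N y) (e-nonNeg N 0≤y))

  S-increasing : ∀ {m n y} → 0# ≤ y → m ℕ.≤′ n → S m y ≤ S n y
  S-increasing 0≤y ℕ.≤′-refl        = ≤-refl
  S-increasing {n = suc n} 0≤y (ℕ.≤′-step m≤n) = ≤-trans (S-increasing 0≤y m≤n) (S-step n 0≤y)

  -- Summing `e-lipschitz` gives the sharper `shifted`, with unequal indices. Weakening it to one
  -- `N` throughout allows the bound to be iterated in steps and passed to the supremum.
  S-lipschitz : ∀ N {x y} → 0# ≤ x → x ≤ y → S N y ≤ S N x + (y - x) * S N y
  S-lipschitz zero {x} {y} 0≤x x≤y =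
      ≤-reflexive (solve 2 (λ x y → con (+ 0) := con (+ 0) :+ (y :- x) :* con (+ 0)) refl x y)
  S-lipschitz (suc N) {x} {y} 0≤x x≤y = ≤-trans (shifted N)
    (+-monoʳ-≤ (S (suc N) x) (*-monoʳ-≤ (≤⇒0≤ x≤y) (S-step N (≤-trans 0≤x x≤y))))
    where
    shifted : ∀ N → S (suc N) y ≤ S (suc N) x + (y - x) * S N y
    shifted zero    =
        ≤-reflexive (solve 2
          (λ x y → con (+ 0) :+ con (+ 1) := con (+ 0) :+ con (+ 1) :+ (y :- x) :* con (+ 0)) refl x y)
    shifted (suc N) = ≤-by _ (+-nonNeg (≤⇒0≤ (shifted N)) (≤⇒0≤ (e-lipschitz N 0≤x x≤y)))
      (solve 8 (λ x y s p s₁y s₁x ey ex →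
          (s₁x :+ ex :+ (y :- x) :* (s :+ p)) :- (s₁y :+ ey)
            := (s₁x :+ (y :- x) :* s :- s₁y) :+ ((y :- x) :* p :- (ey :- ex)))
        refl x y (S N y) (e N y) (S (suc N) y) (S (suc N) x) (e (suc N) y) (e (suc N) x))

  -- With h = 1 / (m + 1), the Lipschitz bound reads m S(x + h) ≤ (m + 1) S(x).
  S-steps : ∀ m k N → fromℕ (m ℕ.^ k) * S N (fromℕ k * fromℕ (suc m) ⁻¹) ≤ fromℕ (suc m ℕ.^ k)
  S-steps m zero N = begin
    fromℕ 1 * S N (0# * h)   ≈⟨ *-congˡ (S-cong N (zeroˡ h)) ⟩
    fromℕ 1 * S N 0#         ≤⟨ *-monoʳ-≤ (fromℕ-nonNeg 1) (S-0≤1 N) ⟩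
    fromℕ 1 * 1#             ≈⟨ trans (*-comm _ _) (*-identityˡ _) ⟩
    fromℕ 1                  ∎
    where
    open ≤-Reasoning
    h = fromℕ (suc m) ⁻¹
    S-at-0 : ∀ N → S (suc N) 0# ≈ 1#
    S-at-0 zero    = +-identityˡ _
    S-at-0 (suc N) = trans (+-cong (S-at-0 N)
      (solve 2 (λ e i → e :* (con (+ 0) :* i) := con (+ 0)) refl (e N 0#) (fromℕ (suc N) ⁻¹)))
        (+-identityʳ _)
    S-0≤1 : ∀ N → S N 0# ≤ 1#
    S-0≤1 zero    = 0≤1
    S-0≤1 (suc N) = ≤-reflexive (S-at-0 N)
  S-steps m (suc k) N = begin
    fromℕ (m ℕ.* m ℕ.^ k) * S N y        ≈⟨ *-congʳ (fromℕ-* m (m ℕ.^ k)) ⟩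
    fromℕ m * p * S N y
        ≈⟨ solve 3 (λ m p s → m :* p :* s := p :* (m :* s)) refl (fromℕ m) p (S N y) ⟩
    p * (fromℕ m * S N y)                ≤⟨ *-monoʳ-≤ (fromℕ-nonNeg (m ℕ.^ k)) one-step ⟩
    p * (M * S N x)
        ≈⟨ solve 3 (λ m p s → p :* (m :* s) := m :* (p :* s)) refl M p (S N x) ⟩
    M * (p * S N x)                      ≤⟨ *-monoʳ-≤ (fromℕ-nonNeg (suc m)) (S-steps m k N) ⟩
    M * fromℕ (suc m ℕ.^ k)              ≈⟨ fromℕ-* (suc m) (suc m ℕ.^ k) ⟨
    fromℕ (suc m ℕ.* suc m ℕ.^ k)        ∎
    where
    open ≤-Reasoning
    M = fromℕ (suc m)
    h = M ⁻¹
    x = fromℕ k * h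
    y = fromℕ (suc k) * h
    p = fromℕ (m ℕ.^ k)
    0≤h : 0# ≤ h
    0≤h = <⇒≤ (⁻¹-pos (fromℕ-pos (suc m)))
    y-x≈h : y - x ≈ h
    y-x≈h = solve 2 (λ k h → (con (+ 1) :+ k) :* h :- k :* h := h) refl (fromℕ k) h
    one-step : fromℕ m * S N y ≤ M * S N x
    one-step = ≤-by _
        (*-nonNeg (fromℕ-nonNeg (suc m)) (≤⇒0≤ (S-lipschitz N (*-nonNeg (fromℕ-nonNeg k) 0≤h)
        (≤-by h 0≤h y-x≈h)))) (begin-equality
      M * S N x - fromℕ m * S N y
        ≈⟨ solve 3 (λ m t s → (con (+ 1) :+ m) :* t :- m :* s :=
          (con (+ 1) :+ m) :* t :+ con (+ 1) :* s :- (con (+ 1) :+ m) :* s) refl (fromℕ m) _ _ ⟩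
      M * S N x + 1# * S N y - M * S N y
        ≈⟨ +-congʳ (+-congˡ
          (*-congʳ (trans (*-congˡ y-x≈h) (*-inverseʳ M (>⇒≉ (fromℕ-pos (suc m))))))) ⟨
      M * S N x + M * (y - x) * S N y - M * S N y
        ≈⟨ solve 4 (λ m t s d → m :* t :+ m :* d :* s :- m :* s := m :* (t :+ d :* s :- s))
          refl M _ _ (y - x) ⟩
      M * (S N x + (y - x) * S N y - S N y) ∎)

  IsSup : (ℝ → Set) → ℝ → Set
  IsSup P u = UpperBound P u × (∀ v → UpperBound P v → u ≤ v)

  E : ℝ → ℝ
  E y = the 0# (IsSup λ v → ∃[ N ] v ≈ S N y)

  -- With `m` equal to 1 in `S-steps`, each step of length 1/2 at most doubles the sum, and at least
  -- 2y steps reach `y`.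
  S-bounded : ∀ {y} → 0# ≤ y → ∃[ b ] (∀ N → S N y ≤ b)
  S-bounded {y} 0≤y = fromℕ (2 ℕ.^ k) , λ N → begin
    S N y                                       ≤⟨ S-mono N 0≤y y≤k/2 ⟩
    S N (fromℕ k * fromℕ 2 ⁻¹)                  ≈⟨ *-identityˡ _ ⟨
    1# * S N (fromℕ k * fromℕ 2 ⁻¹)
        ≈⟨ *-congʳ (trans (reflexive (≡.cong fromℕ (ℕ.^-zeroˡ k))) (+-identityʳ 1#)) ⟨
    fromℕ (1 ℕ.^ k) * S N (fromℕ k * fromℕ 2 ⁻¹) ≤⟨ S-steps 1 k N ⟩
    fromℕ (2 ℕ.^ k)                             ∎
    where
    open ≤-Reasoning
    k = proj₁ (archimedean (fromℕ 2 * y))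
    y≤k/2 : y ≤ fromℕ k * fromℕ 2 ⁻¹
    y≤k/2 = begin
      y                            ≈⟨ *-identityˡ y ⟨
      1# * y                       ≈⟨ *-congʳ (*-inverseʳ (fromℕ 2) (>⇒≉ (fromℕ-pos 2))) ⟨
      fromℕ 2 * fromℕ 2 ⁻¹ * y     ≈⟨ solve 3 (λ t i y → t :* i :* y := t :* y :* i) refl _ _ y ⟩
      fromℕ 2 * y * fromℕ 2 ⁻¹
        ≤⟨ *-monoˡ-≤ (<⇒≤ (⁻¹-pos (fromℕ-pos 2))) (proj₂ (archimedean (fromℕ 2 * y))) ⟩
      fromℕ k * fromℕ 2 ⁻¹         ∎

  E-isSup : ∀ {y} → 0# ≤ y → IsSup (λ v → ∃[ N ] v ≈ S N y) (E y)
  E-isSup 0≤y = the-spec (complete _ (_ , 0 , refl)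
    (proj₁ (S-bounded 0≤y) , λ { _ (N , v≈) → ≤-trans (≤-reflexive v≈) (proj₂ (S-bounded 0≤y) N) }))

  S≤E : ∀ N {y} → 0# ≤ y → S N y ≤ E y
  S≤E N 0≤y = proj₁ (E-isSup 0≤y) _ (N , refl)

  E-least : ∀ {y v} → 0# ≤ y → (∀ N → S N y ≤ v) → E y ≤ v
  E-least 0≤y S≤v = proj₂ (E-isSup 0≤y) _ λ { _ (N , w≈) → ≤-trans (≤-reflexive w≈) (S≤v N) }

  E-mono : ∀ {x y} → 0# ≤ x → x ≤ y → E x ≤ E y
  E-mono 0≤x x≤y = E-least 0≤x λ N → ≤-trans (S-mono N 0≤x x≤y) (S≤E N (≤-trans 0≤x x≤y))

  E-lipschitz : ∀ {x y} → 0# ≤ x → x ≤ y → E y ≤ E x + (y - x) * E y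
  E-lipschitz 0≤x x≤y = E-least 0≤y λ N → ≤-trans (S-lipschitz N 0≤x x≤y)
    (+-mono-≤ (S≤E N 0≤x) (*-monoʳ-≤ (≤⇒0≤ x≤y) (S≤E N 0≤y)))
    where 0≤y = ≤-trans 0≤x x≤y

  1≤E : ∀ {y} → 0# ≤ y → 1# ≤ E y
  1≤E 0≤y = ≤-trans (≤-reflexive (sym (+-identityˡ 1#))) (S≤E 1 0≤y)

  y≤E : ∀ {y} → 0# ≤ y → y ≤ E y
  y≤E {y} 0≤y = ≤-trans (≤-by 1# 0≤1 (begin-equality
    0# + 1# + 1# * (y * fromℕ 1 ⁻¹) - y
      ≈⟨ solve 2 (λ y i → con (+ 0) :+ con (+ 1) :+ con (+ 1) :* (y :* i) :- y :=
        con (+ 1) :+ y :* ((con (+ 1) :+ con (+ 0)) :* i) :- y) refl y (fromℕ 1 ⁻¹) ⟩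
    1# + y * (fromℕ 1 * fromℕ 1 ⁻¹) - y
      ≈⟨ +-congʳ (+-congˡ (*-congˡ (*-inverseʳ (fromℕ 1) (>⇒≉ (fromℕ-pos 1))))) ⟩
    1# + y * 1# - y
      ≈⟨ solve 1 (λ y → con (+ 1) :+ y :* con (+ 1) :- y := con (+ 1)) refl y ⟩
    1# ∎)) (S≤E 2 0≤y)
    where open ≤-Reasoning

  E-0 : E 0# ≤ 1#
  E-0 = E-least ≤-refl λ N → *-cancelˡ-≤ (fromℕ-pos 1) (≤-trans
    (≤-trans (*-monoʳ-≤ (fromℕ-nonNeg 1) (≤-reflexive (S-cong N (sym (zeroˡ _))))) (S-steps 0 0 N))
    (≤-reflexive (trans (sym (*-identityˡ _)) (*-comm _ _))))

  -- Real limits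

  Lim : (ℕ → ℝ) → ℝ → Set
  Lim s l = ∀ ε → 0# < ε → ∃[ N ] (∀ n → N ℕ.≤ n → (s n ≤ l + ε) × (l ≤ s n + ε))

  E-lim : ∀ {y} → 0# ≤ y → Lim (λ N → S N y) (E y)
  E-lim {y} 0≤y ε 0<ε with em {∃[ N ] E y ≤ S N y + ε}
  ... | yes (N , E≤) = N , λ n N≤n →
    ≤-trans (S≤E n 0≤y) (≤-trans (≤-reflexive (sym (+-identityʳ _))) (+-monoʳ-≤ (E y) (<⇒≤ 0<ε))) ,
    ≤-trans E≤ (+-monoˡ-≤ ε (S-increasing 0≤y (ℕ.≤⇒≤′ N≤n)))
  ... | no ¬p = contradiction (E-least 0≤y λ N → ≤-by _ (≤⇒0≤ (<⇒≤ (≰⇒> λ E≤ → ¬p (N , E≤))))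
      (solve 3 (λ E s ε → E :- ε :- s := E :- (s :+ ε)) refl (E y) (S N y) ε))
    λ E≤E-ε → <⇒≱ 0<ε
        (≤-by _ (≤⇒0≤ E≤E-ε) (solve 2 (λ E ε → con (+ 0) :- ε := E :- ε :- E) refl (E y) ε))

  -- A term is the increment from one partial sum to the next, so it is at most the gap left below
  -- the supremum.
  e-vanishes : ∀ {y} → 0# ≤ y → ∀ ε → 0# < ε → ∃[ N ] (∀ n → N ℕ.≤ n → e n y ≤ ε)
  e-vanishes {y} 0≤y ε 0<ε with E-lim 0≤y ε 0<ε
  ... | N , close = N , λ n N≤n →
      ≤-by _ (+-nonNeg (≤⇒0≤ (S≤E (suc n) 0≤y)) (≤⇒0≤ (proj₂ (close n N≤n))))
    (solve 4 (λ ε e s E → ε :- e := (E :- (s :+ e)) :+ (s :+ ε :- E)) refl ε (e n y) (S n y) (E y))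

  Lim-unique : ∀ {s l l′} → Lim s l → Lim s l′ → l ≈ l′
  Lim-unique {s} lim lim′ = antisym (half lim lim′) (half lim′ lim)
    where
    half : ∀ {l l′} → Lim s l → Lim s l′ → l ≤ l′
    half {l} {l′} lim lim′ = ≤-from-2ε λ ε 0<ε →
      let (N , c) = lim ε 0<ε; (N′ , c′) = lim′ ε 0<ε; n = N ℕ.⊔ N′ in
      ≤-by _ (+-nonNeg (≤⇒0≤ (proj₂ (c n (ℕ.m≤m⊔n N N′)))) (≤⇒0≤ (proj₁ (c′ n (ℕ.m≤n⊔m N N′)))))
        (solve 4 (λ l l′ s ε → l′ :+ ε :+ ε :- l := (s :+ ε :- l) :+ (l′ :+ ε :- s)) refl l l′ (s n) ε)

  -- Partial sums at negative arguments

  Within : ℝ → ℝ → Set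
  Within b z = (- b ≤ z) × (z ≤ b)

  within-+ : ∀ {a b x y} → Within a x → Within b y → Within (a + b) (x + y)
  within-+ {a} {b} {x} {y} (p , q) (p′ , q′) =
    ≤-by _ (+-nonNeg (≤⇒0≤ p) (≤⇒0≤ p′))
        (solve 4 (λ a b x y → (x :+ y) :- :- (a :+ b) := (x :- :- a) :+ (y :- :- b)) refl a b x y) ,
    +-mono-≤ q q′

  0<2 : 0# < 1# + 1#
  0<2 = +-pos-nonNeg 0<1 0≤1

  -- Doubling makes ab + xy and ab - xy sums of two products of the nonnegative gaps a - x, a + x, b
  -- - y, b + y, so no case distinction on signs arises.
  within-* : ∀ {a b x y} → Within a x → Within b y → Within (a * b) (x * y)
  within-* {a} {b} {x} {y} (p , q) (p′ , q′) =
    *-cancelˡ-≤ 0<2 (≤-by _ (+-nonNeg (*-nonNeg (≤⇒0≤ q) (≤⇒0≤ q′)) (*-nonNeg (≤⇒0≤ p) (≤⇒0≤ p′)))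
      (solve 4 (λ a b x y →
        (con (+ 1) :+ con (+ 1)) :* (x :* y) :- (con (+ 1) :+ con (+ 1)) :* (:- (a :* b)) :=
          (a :- x) :* (b :- y) :+ (x :- :- a) :* (y :- :- b)) refl a b x y)) ,
    *-cancelˡ-≤ 0<2 (≤-by _ (+-nonNeg (*-nonNeg (≤⇒0≤ q) (≤⇒0≤ p′)) (*-nonNeg (≤⇒0≤ p) (≤⇒0≤ q′)))
      (solve 4 (λ a b x y →
        (con (+ 1) :+ con (+ 1)) :* (a :* b) :- (con (+ 1) :+ con (+ 1)) :* (x :* y) :=
          (a :- x) :* (y :- :- b) :+ (x :- :- a) :* (b :- y)) refl a b x y))

  within-nonNeg : ∀ {x} → 0# ≤ x → Within x x
  within-nonNeg {x} 0≤x =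
      ≤-by _ (+-nonNeg 0≤x 0≤x) (solve 1 (λ x → x :- :- x := x :+ x) refl x) , ≤-refl

  within-cong : ∀ {b b′ x x′} → b ≈ b′ → x ≈ x′ → Within b x → Within b′ x′
  within-cong b≈ x≈ (p , q) =
    ≤-trans (≤-reflexive (-‿cong (sym b≈))) (≤-trans p (≤-reflexive x≈)) ,
    ≤-trans (≤-reflexive (sym x≈)) (≤-trans q (≤-reflexive b≈))

  e-within : ∀ k {t x} → Within t x → Within (e k t) (e k x)
  e-within zero    w = within-nonNeg 0≤1
  e-within (suc k) w =
      within-* (e-within k w) (within-* w (within-nonNeg (<⇒≤ (⁻¹-pos (fromℕ-pos (suc k))))))

  -- The Taylor remainder of e (k + 1) to first order, and the coefficient
  -- of h² in its bound on [- t , t].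
  Δ : ℕ → ℝ → ℝ → ℝ
  Δ k x h = e (suc k) (x + h) - e (suc k) x - h * e k x

  M : ℕ → ℝ → ℝ
  M zero    t = 0#
  M (suc k) t = t * M k t + e k t

  M-nonNeg : ∀ k {t} → 0# ≤ t → 0# ≤ M k t
  M-nonNeg zero    0≤t = ≤-refl
  M-nonNeg (suc k) 0≤t = +-nonNeg (*-nonNeg 0≤t (M-nonNeg k 0≤t)) (e-nonNeg k 0≤t)

  -- `e-rec` carried over to the Taylor remainders. The source term h² e k x explains the recursion
  -- defining `M`.
  Δ-rec : ∀ k x h → fromℕ (2 ℕ.+ k) * Δ (suc k) x h ≈ (x + h) * Δ k x h + h * h * e k x
  Δ-rec k x h = begin-equality
    n * (p - q - h * e₁)
      ≈⟨ solve 5 (λ m p q h e → (con (+ 1) :+ m) :* (p :- q :- h :* e) :=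
        (con (+ 1) :+ m) :* p :- (con (+ 1) :+ m) :* q :- (h :* e :+ h :* (m :* e)))
          refl (fromℕ (suc k)) p q h e₁ ⟩
    n * p - n * q - (h * e₁ + h * (fromℕ (suc k) * e₁))
      ≈⟨ +-cong (+-cong (e-rec (suc k) (x + h)) (-‿cong (e-rec (suc k) x)))
        (-‿cong (+-congˡ (*-congˡ (e-rec k x)))) ⟩
    (x + h) * r - x * e₁ - (h * e₁ + h * (x * e k x))
      ≈⟨ solve 5 (λ x h r e f → (x :+ h) :* r :- x :* e :- (h :* e :+ h :* (x :* f)) :=
        (x :+ h) :* (r :- e :- h :* f) :+ h :* h :* f) refl x h r e₁ (e k x) ⟩
    (x + h) * (r - e₁ - h * e k x) + h * h * e k x ∎
    where
    open ≤-Reasoning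
    n = fromℕ (2 ℕ.+ k)
    p = e (2 ℕ.+ k) (x + h)
    q = e (2 ℕ.+ k) x
    e₁ = e (suc k) x
    r = e (suc k) (x + h)

  within-shrink : ∀ {c b z} → 1# ≤ c → 0# ≤ b → Within b (c * z) → Within b z
  within-shrink {c} {b} {z} 1≤c 0≤b (p , q) =
    *-cancelˡ-≤ 0<c
        (≤-trans (≤-trans (≤-reflexive (solve 2 (λ c b → c :* (:- b) := :- (c :* b)) refl c b))
          (neg-mono-≤ b≤cb)) p) ,
    *-cancelˡ-≤ 0<c (≤-trans q b≤cb)
    where
    0<c : 0# < c
    0<c = ≰⇒> λ c≤0 → <⇒≱ 0<1 (≤-trans 1≤c c≤0)
    b≤cb : b ≤ c * b
    b≤cb = ≤-trans (≤-reflexive (sym (*-identityˡ b))) (*-monoˡ-≤ 0≤b 1≤c)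

  -- The factor k + 2 in `Δ-rec` is simply discarded by `within-shrink`. A crude constant suffices,
  -- because `h` will be chosen small depending on it.
  Δ-within : ∀ k {t x h} → 0# ≤ t → Within t x → Within t (x + h) → Within (h * h * M k t) (Δ k x h)
  Δ-within zero {t} {x} {h} 0≤t w w′ = within-cong
    (sym (zeroʳ _))
    (sym (begin-equality
      1# * ((x + h) * i) - 1# * (x * i) - h * 1#
        ≈⟨ solve 3 (λ x h i →
          con (+ 1) :* ((x :+ h) :* i) :- con (+ 1) :* (x :* i) :- h :* con (+ 1) :=
            h :* ((con (+ 1) :+ con (+ 0)) :* i :- con (+ 1))) refl x h i ⟩
      h * (fromℕ 1 * i - 1#)
        ≈⟨ *-congˡ (+-congʳ (*-inverseʳ _ (>⇒≉ (fromℕ-pos 1)))) ⟩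
      h * (1# - 1#)
        ≈⟨ solve 1 (λ h → h :* (con (+ 1) :- con (+ 1)) := con (+ 0)) refl h ⟩
      0# ∎))
    (within-nonNeg ≤-refl)
    where
    open ≤-Reasoning
    i = fromℕ 1 ⁻¹
  Δ-within (suc k) {t} {x} {h} 0≤t w w′ = within-shrink
    (≤-by _ (fromℕ-nonNeg (suc k))
        (solve 1 (λ m → con (+ 1) :+ m :- con (+ 1) := m) refl (fromℕ (suc k))))
    (*-nonNeg (square-nonNeg h) (M-nonNeg (suc k) 0≤t))
    (within-cong
      (solve 4 (λ t h m e → t :* (h :* h :* m) :+ h :* h :* e := h :* h :* (t :* m :+ e))
        refl t h (M k t) (e k t))
      (sym (Δ-rec k x h))
      (within-+ (within-* w′ (Δ-within k 0≤t w w′))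
        (within-* (within-nonNeg (square-nonNeg h)) (e-within k w))))

  ΣM : ℕ → ℝ → ℝ
  ΣM zero    t = 0#
  ΣM (suc N) t = ΣM N t + M N t

  -- `S N` is the derivative of `S (suc N)`. Only the lower estimate is kept, since its purpose is
  -- to show that a short step does not decrease the sum.
  S-taylor : ∀ N {t x h} → 0# ≤ t → Within t x → Within t (x + h) →
             S (suc N) x + h * S N x ≤ S (suc N) (x + h) + h * h * ΣM N t
  S-taylor zero {h = h} 0≤t w w′ =
      ≤-reflexive (solve 1
        (λ h → con (+ 0) :+ con (+ 1) :+ h :* con (+ 0) :=
          con (+ 0) :+ con (+ 1) :+ h :* h :* con (+ 0)) refl h)
  S-taylor (suc N) {t} {x} {h} 0≤t w w′ = ≤-by _
    (+-nonNeg (≤⇒0≤ (S-taylor N 0≤t w w′)) (≤⇒0≤ (proj₁ (Δ-within N 0≤t w w′))))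
    (solve 9 (λ h sx s₁x ex e₁x s₁y e₁y m m′ →
        (s₁y :+ e₁y :+ h :* h :* (m :+ m′)) :- (s₁x :+ e₁x :+ h :* (sx :+ ex))
          := (s₁y :+ h :* h :* m :- (s₁x :+ h :* sx)) :+ ((e₁y :- e₁x :- h :* ex) :- :- (h :* h :* m′)))
      refl h (S N x) (S (suc N) x) (e N x) (e (suc N) x) (S (suc N) (x + h)) (e (suc N) (x + h))
        (ΣM N t) (M N t))

  -- As long as S (N + 1) ≥ 1 + e N t, its derivative S N is at least 1, so
  -- short steps from - t to 0 cannot decrease it; but it is 1 at 0.
  S-neg : ∀ N {t} → 0# ≤ t → S (suc N) (- t) ≤ 1# + e N t
  S-neg N {t} 0≤t = ≮⇒≥ λ big → <⇒≱ big (≤-trans (≤-trans (walk big n ℕ.≤-refl) end) 1≤1+η)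
    where
    open ≤-Reasoning
    η = e N t
    1≤1+η : 1# ≤ 1# + η
    1≤1+η = ≤-trans (≤-reflexive (sym (+-identityʳ 1#))) (+-monoʳ-≤ 1# (e-nonNeg N 0≤t))
    -- Enough steps that `h * ΣM N t` is at most 1: the second-order loss in a step is then at most
    -- `h`, the guaranteed first-order gain.
    m = proj₁ (archimedean (t * ΣM N t))
    n = suc m
    h = t * fromℕ n ⁻¹
    at : ℕ → ℝ
    at j = - t + fromℕ j * h
    0≤h : 0# ≤ h
    0≤h = *-nonNeg 0≤t (<⇒≤ (⁻¹-pos (fromℕ-pos n)))
    nh≈t : fromℕ n * h ≈ t
    nh≈t = trans (solve 3 (λ n t i → n :* (t :* i) := n :* i :* t) refl (fromℕ n) t (fromℕ n ⁻¹))
      (trans (*-congʳ (*-inverseʳ _ (>⇒≉ (fromℕ-pos n)))) (*-identityˡ t))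
    hM≤1 : h * ΣM N t ≤ 1#
    hM≤1 = *-cancelˡ-≤ (fromℕ-pos n) (begin
      fromℕ n * (h * ΣM N t)   ≈⟨ *-assoc _ _ _ ⟨
      fromℕ n * h * ΣM N t     ≈⟨ *-congʳ nh≈t ⟩
      t * ΣM N t               ≤⟨ proj₂ (archimedean (t * ΣM N t)) ⟩
      fromℕ m                  ≤⟨ fromℕ-mono-≤ (ℕ.n≤1+n m) ⟩
      fromℕ n                  ≈⟨ trans (*-comm _ _) (*-identityˡ _) ⟨
      fromℕ n * 1#             ∎)
    at-within : ∀ j → j ℕ.≤ n → Within t (at j)
    at-within j j≤n =
      ≤-by _ (*-nonNeg (fromℕ-nonNeg j) 0≤h)
        (solve 2 (λ t y → :- t :+ y :- :- t := y) refl t (fromℕ j * h)) ,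
      (begin
        - t + fromℕ j * h    ≤⟨ +-monoʳ-≤ (- t) (*-monoˡ-≤ 0≤h (fromℕ-mono-≤ j≤n)) ⟩
        - t + fromℕ n * h    ≈⟨ trans (+-congˡ nh≈t) (-‿inverseˡ t) ⟩
        0#                   ≤⟨ 0≤t ⟩
        t                    ∎)
    at-suc : ∀ j → at j + h ≈ at (suc j)
    at-suc j = solve 3 (λ t j h → :- t :+ j :* h :+ h := :- t :+ (con (+ 1) :+ j) :* h)
        refl t (fromℕ j) h
    end : S (suc N) (at n) ≤ 1#
    end = begin
      S (suc N) (at n)  ≈⟨ S-cong (suc N) (trans (+-congˡ nh≈t) (-‿inverseˡ t)) ⟩
      S (suc N) 0#      ≤⟨ S≤E (suc N) ≤-refl ⟩
      E 0#              ≤⟨ E-0 ⟩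
      1#                ∎
    walk : 1# + η < S (suc N) (- t) → ∀ j → j ℕ.≤ n → S (suc N) (- t) ≤ S (suc N) (at j)
    walk big zero    _   =
        ≤-reflexive (S-cong (suc N) (solve 2 (λ t h → :- t := :- t :+ con (+ 0) :* h) refl t h))
    walk big (suc j) j<n =
        ≤-trans (walk big j j≤n) (≤-trans step (≤-reflexive (S-cong (suc N) (at-suc j))))
      where
      j≤n = ℕ.<⇒≤ j<n
      w = at-within j j≤n
      -- So far the walk has not dropped below 1 + η, and removing the last term, which is at most
      -- η, leaves at least 1.
      1≤S : 1# ≤ S N (at j)
      1≤S = ≤-by _ (+-nonNeg (≤⇒0≤ (≤-trans (<⇒≤ big) (walk big j j≤n))) (≤⇒0≤ (proj₂ (e-within N w))))
        (solve 3 (λ s e η → s :- con (+ 1) := (s :+ e :- (con (+ 1) :+ η)) :+ (η :- e))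
          refl (S N (at j)) (e N (at j)) η)
      step : S (suc N) (at j) ≤ S (suc N) (at j + h)
      step = ≤-by _
        (+-nonNeg (≤⇒0≤ (S-taylor N 0≤t w (within-cong refl (sym (at-suc j)) (at-within (suc j) j<n))))
          (+-nonNeg (*-nonNeg 0≤h (≤⇒0≤ 1≤S)) (*-nonNeg 0≤h (≤⇒0≤ hM≤1))))
        (solve 5 (λ h s s′ q m → s′ :- s :=
          (s′ :+ h :* h :* m :- (s :+ h :* q)) :+ (h :* (q :- con (+ 1)) :+ h :* (con (+ 1) :- h :* m)))
          refl h (S (suc N) (at j)) (S (suc N) (at j + h)) (S N (at j)) (ΣM N t))

  Lim-S-neg : ∀ {t w} → 0# ≤ t → Lim (λ N → S N (- t)) w → w ≤ 1#
  Lim-S-neg {t} {w} 0≤t lim = ≤-from-2ε λ ε 0<ε →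
    let (N , c) = lim ε 0<ε; (N′ , v) = e-vanishes 0≤t ε 0<ε; n = N ℕ.⊔ N′ in
    ≤-trans (proj₂ (c (suc n) (ℕ.m≤n⇒m≤1+n (ℕ.m≤m⊔n N N′))))
      (+-monoˡ-≤ ε (≤-trans (S-neg n 0≤t) (+-monoʳ-≤ 1# (v n (ℕ.m≤n⊔m N N′)))))

  -- Intermediate values and square roots

  -- The one-sided Lipschitz condition says that `f` cannot jump upwards, and this is enough for the
  -- supremum of the points with value at most `y`: neither `y < f u` nor `f u < y` can hold there.
  intermediateValue : (f : ℝ → ℝ) →
    (∀ b → 0# ≤ b → ∃[ K ] (0# < K × (∀ u v → 0# ≤ u → u ≤ v → v ≤ b → f v ≤ f u + (v - u) * K))) →
    ∀ y → f 0# ≤ y → (∃[ b ] (∀ v → 0# ≤ v → f v ≤ y → v ≤ b)) →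
    ∃[ u ] (0# ≤ u × f u ≈ y)
  intermediateValue f lip y f0≤y (b , bounded) = u , 0≤u , antisym fu≤y y≤fu
    where
    open ≤-Reasoning
    P : ℝ → Set
    P v = 0# ≤ v × f v ≤ y
    sup = complete P (0# , ≤-refl , f0≤y) (b , λ { v (0≤v , fv≤y) → bounded v 0≤v fv≤y })
    u = proj₁ sup
    upper = proj₁ (proj₂ sup)
    0≤u : 0# ≤ u
    0≤u = upper 0# (≤-refl , f0≤y)
    fu≤y : f u ≤ y
    fu≤y = ≮⇒≥ λ y<fu → let
        (K , 0<K , L) = lip u 0≤u
        -- Climbing from a value at most `y` to `f u` takes at least this distance, so `u - h` would
        -- already be an upper bound.
        h = (f u - y) * K ⁻¹
        0<h = *-pos (<⇒0< y<fu) (⁻¹-pos 0<K)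
        hK : h * K ≈ f u - y
        hK = trans (solve 3 (λ d i K → d :* i :* K := d :* (K :* i)) refl (f u - y) (K ⁻¹) K)
          (trans (*-congˡ (*-inverseʳ K (>⇒≉ 0<K))) (trans (*-comm _ _) (*-identityˡ _)))
        u≤u-h : u ≤ u - h
        u≤u-h = proj₂ (proj₂ sup) (u - h) λ { v (0≤v , fv≤y) → *-cancelˡ-≤ 0<K
          (≤-by _ (+-nonNeg (≤⇒0≤ (L v u 0≤v (upper v (0≤v , fv≤y)) ≤-refl)) (≤⇒0≤ fv≤y))
            (begin-equality
            K * (u - h) - K * v
              ≈⟨ solve 4 (λ K u h v → K :* (u :- h) :- K :* v := (u :- v) :* K :- h :* K) refl K u h v ⟩
            (u - v) * K - h * K              ≈⟨ +-congˡ (-‿cong hK) ⟩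
            (u - v) * K - (f u - y)
              ≈⟨ solve 4 (λ d fu fv y → d :- (fu :- y) := (fv :+ d :- fu) :+ (y :- fv))
                refl ((u - v) * K) (f u) (f v) y ⟩
            (f v + (u - v) * K - f u) + (y - f v) ∎)) }
      in <⇒≱ 0<h (≤-by _ (≤⇒0≤ u≤u-h) (solve 2 (λ u h → con (+ 0) :- h := u :- h :- u) refl u h))
    y≤fu : y ≤ f u
    y≤fu = ≮⇒≥ λ fu<y → let
        0≤u+1 = +-nonNeg 0≤u 0≤1
        (K , 0<K , L) = lip (u + 1#) 0≤u+1
        d = y - f u
        0<d = <⇒0< fu<y
        -- Dividing `d` by `d + K` rather than by `K` secures two things at once: `h ≤ 1`, so that
        -- `u + h` stays where `K` is valid, and `h * K ≤ d`.
        c = d + K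
        0<c = +-pos-nonNeg 0<d (<⇒≤ 0<K)
        h = d * c ⁻¹
        0<h = *-pos 0<d (⁻¹-pos 0<c)
        ch : c * h ≈ d
        ch = trans (solve 3 (λ c d i → c :* (d :* i) := c :* i :* d) refl c d (c ⁻¹))
          (trans (*-congʳ (*-inverseʳ c (>⇒≉ 0<c))) (*-identityˡ d))
        h≤1 : h ≤ 1#
        h≤1 = *-cancelˡ-≤ 0<c (≤-trans (≤-reflexive ch)
          (≤-by K (<⇒≤ 0<K) (solve 2 (λ d K → (d :+ K) :* con (+ 1) :- d := K) refl d K)))
        hK≤d : h * K ≤ d
        hK≤d = ≤-trans
          (≤-by _ (*-nonNeg (<⇒≤ 0<h) (<⇒≤ 0<d))
            (solve 3 (λ h d K → (d :+ K) :* h :- h :* K := h :* d) refl h d K))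
          (≤-reflexive ch)
        u≤u+h : u ≤ u + h
        u≤u+h = ≤-trans (≤-reflexive (sym (+-identityʳ u))) (+-monoʳ-≤ u (<⇒≤ 0<h))
        f≤y : f (u + h) ≤ y
        f≤y = begin
          f (u + h)               ≤⟨ L u (u + h) 0≤u u≤u+h (+-monoʳ-≤ u h≤1) ⟩
          f u + (u + h - u) * K
            ≈⟨ solve 4 (λ f u h K → f :+ (u :+ h :- u) :* K := f :+ h :* K) refl (f u) u h K ⟩
          f u + h * K             ≤⟨ +-monoʳ-≤ (f u) hK≤d ⟩
          f u + (y - f u)         ≈⟨ solve 2 (λ f y → f :+ (y :- f) := y) refl (f u) y ⟩
          y                       ∎
      in <⇒≱ 0<h (≤-by _ (≤⇒0≤ (upper (u + h) (≤-trans 0≤u u≤u+h , f≤y)))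
        (solve 2 (λ u h → con (+ 0) :- h := u :- (u :+ h)) refl u h))

  squareRoot : ∀ {x} → 0# ≤ x → ∃[ m ] (0# ≤ m × m * m ≈ x)
  squareRoot {x} 0≤x = intermediateValue (λ m → m * m)
    -- v² - u² is (v - u)(v + u) with v + u at most 2b; the extra 1 keeps the constant positive when
    -- `b` is 0.
    (λ b 0≤b → 1# + (b + b) , +-pos-nonNeg 0<1 (+-nonNeg 0≤b 0≤b) , λ u v 0≤u u≤v v≤b →
      ≤-by _ (*-nonNeg (≤⇒0≤ u≤v) (+-nonNeg 0≤1 (+-nonNeg (≤⇒0≤ v≤b) (≤⇒0≤ (≤-trans u≤v v≤b)))))
        (solve 3 (λ u v b → u :* u :+ (v :- u) :* (con (+ 1) :+ (b :+ b)) :- v :* v :=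
          (v :- u) :* (con (+ 1) :+ ((b :- v) :+ (b :- u)))) refl u v b))
    x (≤-trans (≤-reflexive (zeroˡ 0#)) 0≤x)
    -- A root cannot exceed x + 1, since v > x + 1 gives v² ≥ v (x + 1) > x.
    (x + 1# , λ v 0≤v v²≤x → ≮⇒≥ λ x+1<v → <⇒≱ 0<1 (≤-by _
      (+-nonNeg (≤⇒0≤ v²≤x)
        (+-nonNeg (*-nonNeg 0≤v (≤⇒0≤ (<⇒≤ x+1<v))) (+-nonNeg (*-nonNeg 0≤x 0≤v) (≤⇒0≤ (<⇒≤ x+1<v)))))
      (solve 2 (λ x v → con (+ 0) :- con (+ 1) :=
        (x :- v :* v) :+ (v :* (v :- (x :+ con (+ 1))) :+ (x :* v :+ (v :- (x :+ con (+ 1))))))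
          refl x v)))

  ≤-of-squares : ∀ {a b} → 0# ≤ b → a * a ≤ b * b → a ≤ b
  ≤-of-squares {a} {b} 0≤b a²≤b² = ≮⇒≥ λ b<a → let
      0<a = ≰⇒> λ a≤0 → <⇒≱ b<a (≤-trans a≤0 0≤b)
    in <⇒≱ b<a (*-cancelˡ-≤ 0<a (≤-trans a²≤b² (*-monoˡ-≤ 0≤b (<⇒≤ b<a))))

  -- Complex modulus and complex limits

  open Algebra.Definitions.RawSemiring (RawRing.rawSemiring ℂ-rawRing) using () renaming (_^_ to _^ᶜ_)

  absᶜ-spec : ∀ z → 0# ≤ absᶜ z × absᶜ z * absᶜ z ≈ re z * re z + im z * im z
  absᶜ-spec z = the-spec (squareRoot (+-nonNeg (square-nonNeg (re z)) (square-nonNeg (im z))))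

  Within-of-square : ∀ {x b} → 0# ≤ b → x * x ≤ b * b → Within b x
  Within-of-square {x} {b} 0≤b x²≤b² =
    ≤-trans (neg-mono-≤
        (≤-of-squares 0≤b
          (≤-trans (≤-reflexive (solve 1 (λ x → :- x :* :- x := x :* x) refl x)) x²≤b²)))
            (≤-reflexive (-‿involutive x)) ,
    ≤-of-squares 0≤b x²≤b²

  re-within-absᶜ : ∀ z → Within (absᶜ z) (re z)
  re-within-absᶜ z = let (0≤m , m²) = absᶜ-spec z in Within-of-square 0≤m
    (≤-trans (≤-by _ (square-nonNeg (im z))
        (solve 2 (λ x y → x :* x :+ y :* y :- x :* x := y :* y) refl (re z) (im z)))
          (≤-reflexive (sym m²)))

  im-within-absᶜ : ∀ z → Within (absᶜ z) (im z)
  im-within-absᶜ z = let (0≤m , m²) = absᶜ-spec z in Within-of-square 0≤m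
    (≤-trans (≤-by _ (square-nonNeg (re z))
        (solve 2 (λ x y → x :* x :+ y :* y :- y :* y := x :* x) refl (re z) (im z)))
          (≤-reflexive (sym m²)))

  absᶜ-real-≤ : ∀ {z b} → im z ≈ 0# → Within b (re z) → absᶜ z ≤ b
  absᶜ-real-≤ {z} {b} im≈0 w@(-b≤ , ≤b) = let (_ , m²) = absᶜ-spec z in ≤-of-squares 0≤b (begin
    absᶜ z * absᶜ z              ≈⟨ m² ⟩
    re z * re z + im z * im z    ≈⟨ +-congˡ (trans (*-congˡ im≈0) (zeroʳ _)) ⟩
    re z * re z + 0#             ≈⟨ +-identityʳ _ ⟩
    re z * re z                  ≤⟨ proj₂ (within-* w w) ⟩
    b * b                        ∎)
    where
    open ≤-Reasoning
    0≤b : 0# ≤ b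
    0≤b = *-cancelˡ-≤ 0<2
        (≤-by _ (≤⇒0≤ (≤-trans -b≤ ≤b))
          (solve 1 (λ b → (con (+ 1) :+ con (+ 1)) :* b :- (con (+ 1) :+ con (+ 1)) :* con (+ 0) :=
            b :- :- b) refl b))

  module _ {u l} (u⟶l : u ⟶ l) where

    private
      Lim-part : (π : ℂ → ℝ) → (∀ z w → π (z -ᶜ w) ≈ π z - π w) → (∀ z → Within (absᶜ z) (π z)) →
        Lim (π ∘ u) (π l)
      Lim-part π π-sub within ε 0<ε with u⟶l ε 0<ε
      ... | N , c = N , λ n N≤n →
        let (p , q) = within-cong refl (π-sub (u n) l) (within (u n -ᶜ l))
            ≤ε = <⇒≤ (c n N≤n)
        in ≤-by _ (+-nonNeg (≤⇒0≤ q) (≤⇒0≤ ≤ε))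
          (solve 4 (λ s l ε m → l :+ ε :- s := (m :- (s :- l)) :+ (ε :- m))
            refl (π (u n)) (π l) ε (absᶜ (u n -ᶜ l))) ,
           ≤-by _ (+-nonNeg (≤⇒0≤ p) (≤⇒0≤ ≤ε))
             (solve 4 (λ s l ε m → s :+ ε :- l := (s :- l :- :- m) :+ (ε :- m))
               refl (π (u n)) (π l) ε (absᶜ (u n -ᶜ l)))

    ⟶⇒Lim-re : Lim (re ∘ u) (re l)
    ⟶⇒Lim-re = Lim-part re (λ _ _ → refl) re-within-absᶜ

    ⟶⇒Lim-im : Lim (im ∘ u) (im l)
    ⟶⇒Lim-im = Lim-part im (λ _ _ → refl) im-within-absᶜ

  ⟶-unique : ∀ {u l l′} → u ⟶ l → u ⟶ l′ → l ≈ᶜ l′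
  ⟶-unique p q = Lim-unique (⟶⇒Lim-re p) (⟶⇒Lim-re q) , Lim-unique (⟶⇒Lim-im p) (⟶⇒Lim-im q)

  Lim-cong : ∀ {s s′ l} → (∀ n → s n ≈ s′ n) → Lim s l → Lim s′ l
  Lim-cong s≈s′ lim ε 0<ε with lim ε 0<ε
  ... | N , c = N , λ n N≤n → ≤-trans (≤-reflexive (sym (s≈s′ n))) (proj₁ (c n N≤n)) ,
    ≤-trans (proj₂ (c n N≤n)) (≤-reflexive (+-congʳ (s≈s′ n)))

  Lim⇒⟶ : ∀ {u l} → (∀ n → im (u n) ≈ 0#) → Lim (re ∘ u) l → u ⟶ ofReal l
  -- Half of ε leaves room for the strict inequality demanded by `_⟶_`.
  Lim⇒⟶ {u} {l} im≈0 lim ε 0<ε with lim (ε * fromℕ 2 ⁻¹) (*-pos 0<ε (⁻¹-pos (fromℕ-pos 2)))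
  ... | N , c = N , λ n N≤n →
      ≤-<-trans (absᶜ-real-≤ (trans (+-congʳ (im≈0 n)) (trans (+-identityˡ _) -0#≈0#))
      (≤-by _ (≤⇒0≤ (proj₂ (c n N≤n)))
        (solve 3 (λ s l ε → s :- l :- :- ε := s :+ ε :- l) refl (re (u n)) l ε′) ,
       ≤-by _ (≤⇒0≤ (proj₁ (c n N≤n)))
         (solve 3 (λ s l ε → ε :- (s :- l) := l :+ ε :- s) refl (re (u n)) l ε′)))
    where
    open ≤-Reasoning
    ε′ = ε * fromℕ 2 ⁻¹
    0<ε′ : 0# < ε′
    0<ε′ = *-pos 0<ε (⁻¹-pos (fromℕ-pos 2))
    ε≈ε′+ε′ : ε ≈ ε′ + ε′
    ε≈ε′+ε′ = trans (sym (*-identityʳ ε))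
        (trans (*-congˡ (sym (*-inverseʳ (fromℕ 2) (>⇒≉ (fromℕ-pos 2)))))
      (solve 2 (λ ε i → ε :* ((con (+ 1) :+ (con (+ 1) :+ con (+ 0))) :* i) := ε :* i :+ ε :* i)
        refl ε (fromℕ 2 ⁻¹)))
    ≤-<-trans : ∀ {x} → x ≤ ε′ → x < ε
    ≤-<-trans x≤ε′ = ≰⇒> λ ε≤x → <⇒≱ 0<ε′ (≤-by _ (≤⇒0≤ (≤-trans ε≤x x≤ε′))
      (trans (solve 2 (λ ε e → con (+ 0) :- e := e :- (e :+ e)) refl ε ε′)
        (+-congˡ (-‿cong (sym ε≈ε′+ε′)))))

  -- The complex exponential at real arguments

  -- `∑[_]` unfolds at its first term and `S` at its last. Applying an additive projection moves the
  -- rearrangement into ℝ, where the ring laws are at hand.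
  ∑-snoc : (π : ℂ → ℝ) → π 0ᶜ ≈ 0# → (∀ z w → π (z +ᶜ w) ≈ π z + π w) →
           ∀ N f → π (∑[ suc N ] f) ≈ π (∑[ N ] f) + π (f N)
  ∑-snoc π π-0 π-+ zero    f = trans (π-+ _ _) (+-comm _ _)
  ∑-snoc π π-0 π-+ (suc N) f = begin-equality
    π (∑[ suc (suc N) ] f)                               ≈⟨ π-+ _ _ ⟩
    π (f 0) + π (∑[ suc N ] (f ∘ suc))                   ≈⟨ +-congˡ (∑-snoc π π-0 π-+ N (f ∘ suc)) ⟩
    π (f 0) + (π (∑[ N ] (f ∘ suc)) + π (f (suc N)))     ≈⟨ +-assoc _ _ _ ⟨
    π (f 0) + π (∑[ N ] (f ∘ suc)) + π (f (suc N))       ≈⟨ +-congʳ (π-+ _ _) ⟨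
    π (∑[ suc N ] f) + π (f (suc N))                     ∎
    where open ≤-Reasoning

  power-real : ∀ y k → (re (ofReal y ^ᶜ k) ≈ e k y * fromℕ (k !)) × (im (ofReal y ^ᶜ k) ≈ 0#)
  power-real y zero    = sym (trans (*-identityˡ _) (+-identityʳ 1#)) , refl
  power-real y (suc k) = let (r , i) = power-real y k in
    (begin-equality
      y * p - 0# * q
        ≈⟨ solve 3 (λ y p q → y :* p :- con (+ 0) :* q := y :* p) refl y p q ⟩
      y * p                                   ≈⟨ *-congˡ r ⟩
      y * (e k y * fromℕ (k !))               ≈⟨ *-assoc _ _ _ ⟨
      y * e k y * fromℕ (k !)                 ≈⟨ *-congʳ (e-rec k y) ⟨
      fromℕ (suc k) * e (suc k) y * fromℕ (k !)
        ≈⟨ solve 3 (λ m e f → m :* e :* f := e :* (m :* f)) refl _ _ _ ⟩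
      e (suc k) y * (fromℕ (suc k) * fromℕ (k !)) ≈⟨ *-congˡ (fromℕ-* (suc k) (k !)) ⟨
      e (suc k) y * fromℕ (suc k !)           ∎) ,
    trans (+-congʳ (*-congˡ i))
        (solve 2 (λ y p → y :* con (+ 0) :+ con (+ 0) :* p := con (+ 0)) refl y p)
    where
    open ≤-Reasoning
    p = re (ofReal y ^ᶜ k)
    q = im (ofReal y ^ᶜ k)

  expTerm : ℂ → ℕ → ℂ
  expTerm z k = (z ^ᶜ k) *ᶜ ofReal (fromℕ (k !) ⁻¹)

  expTerm-real : ∀ y k → (re (expTerm (ofReal y) k) ≈ e k y) × (im (expTerm (ofReal y) k) ≈ 0#)
  expTerm-real y k = let (r , i) = power-real y k in
    (begin-equality
      p * f ⁻¹ - q * 0#      ≈⟨ solve 3 (λ p q f → p :* f :- q :* con (+ 0) := p :* f) refl p q (f ⁻¹) ⟩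
      p * f ⁻¹               ≈⟨ *-congʳ r ⟩
      e k y * f * f ⁻¹       ≈⟨ *-assoc _ _ _ ⟩
      e k y * (f * f ⁻¹)     ≈⟨ *-congˡ (*-inverseʳ f (>⇒≉ (fromℕ-pos (k !) {{k ℕ.!≢0}}))) ⟩
      e k y * 1#             ≈⟨ *-identityʳ _ ⟩
      e k y                  ∎) ,
    trans (+-congˡ (*-congʳ i))
        (solve 2 (λ p f → p :* con (+ 0) :+ con (+ 0) :* f := con (+ 0)) refl p (f ⁻¹))
    where
    open ≤-Reasoning
    p = re (ofReal y ^ᶜ k)
    q = im (ofReal y ^ᶜ k)
    f = fromℕ (k !)

  expSum : ℂ → ℕ → ℂ
  expSum z N = ∑[ N ] (expTerm z)

  re-expSum : ∀ y N → re (expSum (ofReal y) N) ≈ S N y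
  re-expSum y zero    = refl
  re-expSum y (suc N) =
      trans (∑-snoc re refl (λ _ _ → refl) N (expTerm (ofReal y)))
        (+-cong (re-expSum y N) (proj₁ (expTerm-real y N)))

  im-expSum : ∀ y N → im (expSum (ofReal y) N) ≈ 0#
  im-expSum y zero    = refl
  im-expSum y (suc N) = trans (∑-snoc im refl (λ _ _ → refl) N (expTerm (ofReal y)))
    (trans (+-cong (im-expSum y N) (proj₂ (expTerm-real y N))) (+-identityʳ 0#))

  exp-nonNeg : ∀ {y} → 0# ≤ y → exp (ofReal y) ≈ᶜ ofReal (E y)
  exp-nonNeg {y} 0≤y = ⟶-unique (the-spec {P = expSum (ofReal y) ⟶_} (ofReal (E y) , conv)) conv
    where
    conv : expSum (ofReal y) ⟶ ofReal (E y)
    conv = Lim⇒⟶ (im-expSum y) (Lim-cong (λ n → sym (re-expSum y n)) (E-lim 0≤y))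

  -- Covers both outcomes of `the`. In `exp-nonPos` the value is either a limit of the series or the
  -- default `0ᶜ`, whose real part also satisfies the bound.
  the-elim : ∀ {A : Set} (default : A) (P : A → Set) (Q : A → Set) → Q default → (∀ x → P x → Q x) →
      Q (the default P)
  the-elim {A} default P Q qd q with em {Σ A P}
  ... | yes (x , p) = q x p
  ... | no  _       = qd

  exp-nonPos : ∀ {y} → y ≤ 0# → re (exp (ofReal y)) ≤ 1#
  exp-nonPos {y} y≤0 = the-elim 0ᶜ (expSum (ofReal y) ⟶_) (λ w → re w ≤ 1#) 0≤1 λ w conv →
    Lim-S-neg {t = - y} (≤-trans (≤-reflexive (sym -0#≈0#)) (neg-mono-≤ y≤0))
      (Lim-cong (λ n → trans (re-expSum y n) (S-cong n (sym (-‿involutive y)))) (⟶⇒Lim-re conv))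

  -- The logarithm above 1

  E-surjective : ∀ {x} → 1# ≤ x → ∃[ y ] (0# ≤ y × E y ≈ x)
  E-surjective {x} 1≤x = intermediateValue E
    (λ b 0≤b → E b ,
        (≤-trans 0≤1 (1≤E 0≤b) , λ 0≈E → <⇒≱ 0<1 (≤-trans (1≤E 0≤b) (≤-reflexive (sym 0≈E)))) ,
      λ u v 0≤u u≤v v≤b →
        ≤-trans (E-lipschitz 0≤u u≤v)
          (+-monoʳ-≤ (E u) (*-monoʳ-≤ (≤⇒0≤ u≤v) (E-mono (≤-trans 0≤u u≤v) v≤b))))
    x (≤-trans E-0 1≤x) (x , λ v 0≤v Ev≤x → ≤-trans (y≤E 0≤v) Ev≤x)

  -- Existence of a logarithm comes from `E-surjective`, but `log x` may be another solution. By
  -- `exp-nonPos` a negative one would have exponential at most 1, so the chosen value lies where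
  -- `E` describes `exp`.
  log-spec : ∀ {x} → 1# < x → 0# ≤ log x × E (log x) ≈ x
  log-spec {x} 1<x = 0≤log , trans (sym (proj₁ (exp-nonNeg 0≤log))) (proj₁ exp-log)
    where
    exp-log : exp (ofReal (log x)) ≈ᶜ ofReal x
    exp-log = the-spec {P = λ y → exp (ofReal y) ≈ᶜ ofReal x}
      (let (y , 0≤y , Ey≈x) = E-surjective (<⇒≤ 1<x)
           (r , i)          = exp-nonNeg 0≤y
       in y , trans r Ey≈x , i)
    0≤log : 0# ≤ log x
    0≤log = ≮⇒≥ λ log<0 → <⇒≱ 1<x (≤-trans (≤-reflexive (sym (proj₁ exp-log))) (exp-nonPos (<⇒≤ log<0)))

  -- A positive lower bound for the iterated logarithm

  -- A rational strictly between 1 and log 3, reached in n + 1 steps of length 1/n with n = 16. This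
  -- is the least n for which the resulting bound (n / (n - 1))ⁿ⁺¹ on `E` falls below 3.
  17/16 : ℝ
  17/16 = fromℕ 17 * fromℕ 16 ⁻¹

  0≤17/16 : 0# ≤ 17/16
  0≤17/16 = *-nonNeg (fromℕ-nonNeg 17) (<⇒≤ (⁻¹-pos (fromℕ-pos 16)))

  1<17/16 : 1# < 17/16
  1<17/16 = ≰⇒> λ 17/16≤1 → <⇒≱ (fromℕ-mono-< {16} {17} ℕ.≤-refl) (begin
    fromℕ 17                        ≈⟨ *-identityʳ _ ⟨
    fromℕ 17 * 1#                   ≈⟨ *-congˡ (*-inverseʳ (fromℕ 16) (>⇒≉ (fromℕ-pos 16))) ⟨
    fromℕ 17 * (fromℕ 16 * fromℕ 16 ⁻¹)
        ≈⟨ solve 3 (λ x y z → x :* (y :* z) := y :* (x :* z)) refl (fromℕ 17) (fromℕ 16) (fromℕ 16 ⁻¹) ⟩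
    fromℕ 16 * 17/16                    ≤⟨ *-monoʳ-≤ (fromℕ-nonNeg 16) 17/16≤1 ⟩
    fromℕ 16 * 1#                   ≈⟨ *-identityʳ _ ⟩
    fromℕ 16                        ∎)
    where open ≤-Reasoning

  E-< : ∀ {y} p q n → .{{NonZero p}} → 0# ≤ y → (∀ N → fromℕ p * S N y ≤ fromℕ q) → q ℕ.< p ℕ.* n →
      E y < fromℕ n
  E-< {y} p q n 0≤y bound q<pn = ≰⇒> λ n≤E → <⇒≱ (fromℕ-mono-< q<pn) (begin
    fromℕ (p ℕ.* n)               ≈⟨ fromℕ-* p n ⟩
    fromℕ p * fromℕ n
        ≤⟨ *-monoʳ-≤ (<⇒≤ 0<p)
          (≤-trans n≤E (E-least 0≤y λ N → *-cancelˡ-≤ 0<p (≤-trans (bound N) (≤-reflexive (sym pv))))) ⟩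
    fromℕ p * (fromℕ q * fromℕ p ⁻¹) ≈⟨ pv ⟩
    fromℕ q                       ∎)
    where
    open ≤-Reasoning
    0<p = fromℕ-pos p
    pv : fromℕ p * (fromℕ q * fromℕ p ⁻¹) ≈ fromℕ q
    pv = trans (solve 3 (λ p q i → p :* (q :* i) := p :* i :* q) refl (fromℕ p) (fromℕ q) (fromℕ p ⁻¹))
      (trans (*-congʳ (*-inverseʳ _ (>⇒≉ 0<p))) (*-identityˡ _))

  -- (16/15)¹⁷ < 3.
  E[17/16]<3 : E 17/16 < fromℕ 3
  E[17/16]<3 = E-< (15 ℕ.^ 17) (16 ℕ.^ 17) 3 0≤17/16 (S-steps 15 17)
      (ℕ.<ᵇ⇒< (16 ℕ.^ 17) (15 ℕ.^ 17 ℕ.* 3) _)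

  17/16≤log : ∀ {x} → fromℕ 3 ≤ x → 17/16 ≤ log x
  17/16≤log {x} 3≤x = ≮⇒≥ λ log<17/16 → <⇒≱ E[17/16]<3 (begin
    fromℕ 3     ≤⟨ 3≤x ⟩
    x           ≈⟨ proj₂ spec ⟨
    E (log x)   ≤⟨ E-mono (proj₁ spec) (<⇒≤ log<17/16) ⟩
    E 17/16         ∎)
    where
    open ≤-Reasoning
    1<x : 1# < x
    1<x = begin-strict
      1#       ≈⟨ +-identityʳ 1# ⟨
      fromℕ 1  <⟨ fromℕ-mono-< {1} {3} (s≤s (s≤s z≤n)) ⟩
      fromℕ 3  ≤⟨ 3≤x ⟩
      x        ∎
    spec = log-spec 1<x

  -- The inequality log u ≥ 1 - 1/u at u = 17/16, so the value is 1/17.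
  κ : ℝ
  κ = 1# - 17/16 ⁻¹

  17/16*κ : 17/16 * κ ≈ 17/16 - 1#
  17/16*κ = trans (solve 2 (λ x i → x :* (con (+ 1) :- i) := x :- x :* i) refl 17/16 (17/16 ⁻¹))
    (+-congˡ (-‿cong (*-inverseʳ 17/16 (>⇒≉ (≰⇒> λ 17/16≤0 → <⇒≱ 1<17/16 (≤-trans 17/16≤0 0≤1))))))

  0<17/16 : 0# < 17/16
  0<17/16 = ≰⇒> λ 17/16≤0 → <⇒≱ 1<17/16 (≤-trans 17/16≤0 0≤1)

  0<κ : 0# < κ
  0<κ = ≰⇒> λ κ≤0 → <⇒≱ (<⇒0< 1<17/16) (begin
    17/16 - 1#   ≈⟨ 17/16*κ ⟨
    17/16 * κ    ≤⟨ *-monoʳ-≤ 0≤17/16 κ≤0 ⟩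
    17/16 * 0#   ≈⟨ zeroʳ 17/16 ⟩
    0#       ∎)
    where open ≤-Reasoning

  -- E z (1 - z) ≤ 1 for 0 ≤ z, so E z ≥ 17/16 forces 1 - z ≤ 16/17.
  κ≤log : ∀ {x} → 17/16 ≤ x → κ ≤ log x
  κ≤log {x} 17/16≤x = ≮⇒≥ λ z<κ → <⇒≱ (*-pos 0<17/16 (<⇒0< z<κ)) (≤-by _
      (+-nonNeg (≤⇒0≤ (E-lipschitz ≤-refl 0≤z))
        (+-nonNeg (≤⇒0≤ E-0) (*-nonNeg (≤⇒0≤ (≤-trans 17/16≤x (≤-reflexive (sym Ez≈x)))) (0≤1-z z<κ))))
      (begin-equality
        0# - 17/16 * (κ - z)
          ≈⟨ solve 3 (λ x b z → con (+ 0) :- x :* (b :- z) := x :* z :- x :* b) refl 17/16 κ z ⟩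
        17/16 * z - 17/16 * κ                                          ≈⟨ +-congˡ (-‿cong 17/16*κ) ⟩
        17/16 * z - (17/16 - 1#)
          ≈⟨ solve 4 (λ x z e e₀ → x :* z :- (x :- con (+ 1)) :=
          (e₀ :+ (z :- con (+ 0)) :* e :- e) :+ ((con (+ 1) :- e₀) :+ (e :- x) :* (con (+ 1) :- z)))
            refl 17/16 z (E z) (E 0#) ⟩
        (E 0# + (z - 0#) * E z - E z) + ((1# - E 0#) + (E z - 17/16) * (1# - z)) ∎))
    where
    open ≤-Reasoning
    z = log x
    spec = log-spec (≰⇒> λ x≤1 → <⇒≱ 1<17/16 (≤-trans 17/16≤x x≤1))
    0≤z = proj₁ spec
    Ez≈x = proj₂ spec
    0≤1-z : z < κ → 0# ≤ 1# - z
    0≤1-z z<κ = ≤⇒0≤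
        (≤-trans (<⇒≤ z<κ)
          (≤-by _ (<⇒≤ (⁻¹-pos 0<17/16))
            (solve 1 (λ i → con (+ 1) :- (con (+ 1) :- i) := i) refl (17/16 ⁻¹))))

  -- Integer parts and nearest integers

  leastℕ : (P : ℕ → Set) → ∃ P → ∃[ m ] (P m × (∀ k → P k → m ℕ.≤ k))
  leastℕ P (n , p) = go n n ℕ.≤-refl p
    where
    go : ∀ b n → n ℕ.≤ b → P n → ∃[ m ] (P m × (∀ k → P k → m ℕ.≤ k))
    go zero    zero    _   p = zero , p , λ _ _ → z≤n
    go (suc b) n n≤1+b p with em {∃[ k ] (k ℕ.< n × P k)}
    ... | yes (k , k<n , q) = go b k (ℕ.s≤s⁻¹ (ℕ.≤-trans k<n n≤1+b)) q
    ... | no  ∄k            = n , p , λ k q → ℕ.≮⇒≥ λ k<n → ∄k (k , k<n , q)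

  floor : ∀ {x} → 0# ≤ x → ∃[ D ] (fromℕ D ≤ x × (∀ k → fromℕ k ≤ x → k ℕ.≤ D))
  floor {x} 0≤x with leastℕ (λ n → x < fromℕ n) (let (n , x≤n) = archimedean x in
    suc n , ≰⇒> λ 1+n≤x → <⇒≱ (fromℕ-mono-< {n} {suc n} ℕ.≤-refl) (≤-trans 1+n≤x x≤n))
  ... | zero  , x<0   , _     = contradiction 0≤x (<⇒≱ x<0)
  ... | suc D , x<1+D , least = D , ≮⇒≥ (λ x<D → ℕ.<-irrefl ≡.refl (least D x<D)) ,
    λ k k≤x → ℕ.≮⇒≥ λ D<k → <⇒≱ x<1+D (≤-trans (fromℕ-mono-≤ D<k) k≤x)

  abs-fromℤ-* : ∀ i {w z} → 0# ≤ w → z ≈ fromℤ i * w → abs z ≈ fromℕ ℤ.∣ i ∣ * w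
  abs-fromℤ-* (+ n)    {w} 0≤w z≈ =
      trans (abs-nonNeg (≤-trans (*-nonNeg (fromℕ-nonNeg n) 0≤w) (≤-reflexive (sym z≈)))) z≈
  abs-fromℤ-* -[1+ n ] {w} {z} 0≤w z≈ = trans (abs-nonPos z≤0) -z≈
    where
    -z≈ : - z ≈ fromℕ (suc n) * w
    -z≈ = trans (-‿cong z≈) (solve 2 (λ n w → :- (:- n :* w) := n :* w) refl (fromℕ (suc n)) w)
    z≤0 : z ≤ 0#
    z≤0 = ≤-by _ (*-nonNeg (fromℕ-nonNeg (suc n)) 0≤w) (trans (+-identityˡ (- z)) -z≈)

  module _ (a : ℕ) .{{_ : NonZero a}} (p : ℕ) where

    private
      w : ℝ
      w = fromℕ a ⁻¹
      0<w : 0# < w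
      0<w = ⁻¹-pos (fromℕ-pos a)
      t : ℝ
      t = fromℕ p * w
      residue : ℤ → ℤ
      residue n = + p ℤ.- n ℤ.* + a

    -- Clearing the denominator `a` turns distances to integers into absolute values of integer
    -- residues, so that minimising them is a matter of natural numbers.
    distance : ∀ n → abs (t - fromℤ n) ≈ fromℕ ℤ.∣ residue n ∣ * w
    distance n = abs-fromℤ-* (residue n) (<⇒≤ 0<w) (begin-equality
      fromℕ p * w - fromℤ n                         ≈⟨ +-congˡ (-‿cong (*-identityʳ _)) ⟨
      fromℕ p * w - fromℤ n * 1#
        ≈⟨ +-congˡ (-‿cong (*-congˡ (*-inverseʳ _ (>⇒≉ (fromℕ-pos a))))) ⟨
      fromℕ p * w - fromℤ n * (fromℕ a * w)
        ≈⟨ solve 4 (λ p w n a → p :* w :- n :* (a :* w) := (p :- n :* a) :* w)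
          refl (fromℕ p) w (fromℤ n) (fromℕ a) ⟩
      (fromℕ p - fromℤ n * fromℕ a) * w             ≈⟨ *-congʳ (+-congˡ (-‿cong (fromℤ-* n (+ a)))) ⟨
      (fromℕ p - fromℤ (n ℤ.* + a)) * w             ≈⟨ *-congʳ (+-congˡ (fromℤ-neg (n ℤ.* + a))) ⟨
      (fromℕ p + fromℤ (ℤ.- (n ℤ.* + a))) * w       ≈⟨ *-congʳ (fromℤ-+ (+ p) (ℤ.- (n ℤ.* + a))) ⟨
      fromℤ (residue n) * w                         ∎)
      where open ≤-Reasoning

    -- `‖_‖` is a definite description and has content only once the minimum is attained; a residue
    -- of least absolute value attains it.
    nearestInteger : ∃[ n ] (‖ t ‖ ≈ abs (t - fromℤ n))
    nearestInteger with leastℕ (λ k → ∃[ n ] ℤ.∣ residue n ∣ ≡ k) (_ , + 0 , ≡.refl)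
    ... | _ , (n , ≡.refl) , least =
        proj₁ (the-spec {P = λ m → (∃[ n ] m ≈ abs (t - fromℤ n)) × (∀ n → m ≤ abs (t - fromℤ n))}
          (abs (t - fromℤ n) , (n , refl) , λ m → begin
      abs (t - fromℤ n)               ≈⟨ distance n ⟩
      fromℕ ℤ.∣ residue n ∣ * w       ≤⟨ *-monoˡ-≤ (<⇒≤ 0<w) (fromℕ-mono-≤ (least _ (m , ≡.refl))) ⟩
      fromℕ ℤ.∣ residue m ∣ * w       ≈⟨ distance m ⟨
      abs (t - fromℤ m)               ∎))
      where open ≤-Reasoning

    ‖‖≤⇒residue≤ : ∀ {δ} → ‖ t ‖ ≤ δ → ∃[ n ] (fromℕ ℤ.∣ residue n ∣ ≤ δ * fromℕ a)
    ‖‖≤⇒residue≤ {δ} ‖t‖≤δ with nearestInteger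
    ... | n , ‖t‖≈ = n , (begin
      k                      ≈⟨ *-identityʳ _ ⟨
      k * 1#                 ≈⟨ *-congˡ (trans (*-comm _ _) (*-inverseʳ _ (>⇒≉ (fromℕ-pos a)))) ⟨
      k * (w * fromℕ a)      ≈⟨ *-assoc _ _ _ ⟨
      k * w * fromℕ a
        ≤⟨ *-monoˡ-≤ (fromℕ-nonNeg a)
          (≤-trans (≤-reflexive (trans (sym (distance n)) (sym ‖t‖≈))) ‖t‖≤δ) ⟩
      δ * fromℕ a            ∎)
      where
      open ≤-Reasoning
      k = fromℕ ℤ.∣ residue n ∣

  -- From the counting bound to the estimate for A

  A-bound : ∀ (a : ℕ) .{{_ : NonZero a}} (r : ℕ) → IsLargestSquareDivisorRoot a r → ∀ δ → 0# < δ →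
    fromℕ (A a δ) ≤ fromℕ 4 * (δ * fromℕ a * fromℕ (d a)) + fromℕ (σ r)
  A-bound a r isRoot δ 0<δ = let (D , D≤ , maximal) = floor (*-nonNeg (<⇒≤ 0<δ) (fromℕ-nonNeg a)) in begin
    fromℕ (A a δ)
      -- A residue has integer absolute value, so being at most δa it is at most the integer part
      -- `D`.
      ≤⟨ fromℕ-mono-≤ (#-nearSquares isRoot D (λ x → em {‖ fromℕ (x ℕ.* x) * fromℕ a ⁻¹ ‖ ≤ δ})
           (λ x near → let (n , ≤δa) = ‖‖≤⇒residue≤ a (x ℕ.* x) near in n , maximal _ ≤δa)) ⟩
    fromℕ (4 ℕ.* (D ℕ.* d a) ℕ.+ σ r)
      ≈⟨ fromℕ-+ (4 ℕ.* (D ℕ.* d a)) (σ r) ⟩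
    fromℕ (4 ℕ.* (D ℕ.* d a)) + fromℕ (σ r)
      ≈⟨ +-congʳ (trans (fromℕ-* 4 (D ℕ.* d a)) (*-congˡ (fromℕ-* D (d a)))) ⟩
    fromℕ 4 * (fromℕ D * fromℕ (d a)) + fromℕ (σ r)
      ≤⟨ +-monoˡ-≤ (fromℕ (σ r)) (*-monoʳ-≤ (fromℕ-nonNeg 4) (*-monoˡ-≤ (fromℕ-nonNeg (d a)) D≤)) ⟩
    fromℕ 4 * (δ * fromℕ a * fromℕ (d a)) + fromℕ (σ r) ∎
    where open ≤-Reasoning

  -- The summand 4/κ trades the missing factor log log 3a, which is at least κ, for a constant; the
  -- summand 1 covers σ(r). The value is 69.
  constant : ℝ
  constant = 1# + fromℕ 4 * κ ⁻¹

  A≪ : ∀ (a : ℕ) .{{_ : NonZero a}} (r : ℕ) → IsLargestSquareDivisorRoot a r →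
        ∀ (δ : ℝ) → 0# < δ → δ < ½ →
        abs (fromℕ (A a δ)) ≤
          constant * abs (δ * fromℕ a * log (log (fromℕ (3 ℕ.* a))) * fromℕ (d a) + fromℕ (σ r))
  A≪ a r isRoot δ 0<δ _ = begin
    abs (fromℕ (A a δ))   ≈⟨ abs-nonNeg (fromℕ-nonNeg (A a δ)) ⟩
    fromℕ (A a δ)         ≤⟨ A-bound a r isRoot δ 0<δ ⟩
    fromℕ 4 * (δ * fromℕ a * fromℕ (d a)) + s
      ≤⟨ ≤-by _ (+-nonNeg (*-nonNeg 0≤L 0≤Z)
        (+-nonNeg (*-nonNeg (*-nonNeg 0≤4i (≤⇒0≤ κ≤L)) 0≤Z) (*-nonNeg 0≤4i (fromℕ-nonNeg (σ r)))))
           (begin-equality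
             constant * Y - (four * Z + s)
               ≈⟨ solve 8 (λ f i δ a L d s b →
                 (con (+ 1) :+ f :* i) :* (δ :* a :* L :* d :+ s) :- (f :* (δ :* a :* d) :+ s)
                    := (L :* (δ :* a :* d) :+
                      (f :* i :* (L :- b) :* (δ :* a :* d) :+ f :* i :* s)) :+
                        (f :* (b :* i :- con (+ 1)) :* (δ :* a :* d)))
                    refl four i δ (fromℕ a) L (fromℕ (d a)) s κ ⟩
             (L * Z + (four * i * (L - κ) * Z + four * i * s)) + four * (κ * i - 1#) * Z
               ≈⟨ +-congˡ (*-congʳ (*-congˡ (+-congʳ (*-inverseʳ κ (>⇒≉ 0<κ))))) ⟩
             (L * Z + (four * i * (L - κ) * Z + four * i * s)) + four * (1# - 1#) * Z
               ≈⟨ solve 3 (λ x f z → x :+ f :* (con (+ 1) :- con (+ 1)) :* z := x) refl _ four Z ⟩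
             L * Z + (four * i * (L - κ) * Z + four * i * s) ∎) ⟩
    constant * Y                 ≤⟨ *-monoʳ-≤ 0≤constant (abs-≥ Y) ⟩
    constant * abs Y             ∎
    where
    open ≤-Reasoning
    four = fromℕ 4
    i = κ ⁻¹
    s = fromℕ (σ r)
    L = log (log (fromℕ (3 ℕ.* a)))
    Z = δ * fromℕ a * fromℕ (d a)
    Y = δ * fromℕ a * L * fromℕ (d a) + s
    0≤Z : 0# ≤ Z
    0≤Z = *-nonNeg (*-nonNeg (<⇒≤ 0<δ) (fromℕ-nonNeg a)) (fromℕ-nonNeg (d a))
    0≤4i : 0# ≤ four * i
    0≤4i = *-nonNeg (fromℕ-nonNeg 4) (<⇒≤ (⁻¹-pos 0<κ))
    0≤constant : 0# ≤ constant
    0≤constant = +-nonNeg 0≤1 0≤4i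
    κ≤L : κ ≤ L
    κ≤L = κ≤log (17/16≤log (fromℕ-mono-≤ (ℕ.*-monoʳ-≤ 3 (ℕ.>-nonZero⁻¹ a))))
    0≤L : 0# ≤ L
    0≤L = ≤-trans (<⇒≤ 0<κ) κ≤L

theorem5 : (em : ExcludedMiddle 0ℓ) (R : CompleteOrderedField) →
    let open Analysis em R in
    GeneralizedRiemannHypothesis →
    ∃[ C ] (∀ (a : ℕ) .{{_ : NonZero a}} (r : ℕ) → IsLargestSquareDivisorRoot a r →
    ∀ (δ : ℝ) → 0# < δ → δ < ½ →
    abs (fromℕ (A a δ)) ≤
    C * abs (δ * fromℕ a * log (log (fromℕ (3 ℕ.* a))) * fromℕ (d a) + fromℕ (σ r)))
theorem5 em R _ = RealAnalysis.constant em R , RealAnalysis.A≪ em R
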